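{- Let $(\mathbf r,\mathbf h)$ be a pattern, with $\mathbf r=(r_1,\dots,r_t)$ and $\mathbf h=(h_1,\dots,h_t)$, and let $H=\sum_{j=1}^t h_j$ and $B=\sum_{j=1}^t h_j|r_j|$. Assume that $p\neq q$ are primes such that $p>B$, $q>B$, $p\nmid r_1\cdots r_t$ and $q\nmid r_1\cdots r_t$. Then $$T^{(pq;p)}_{\mathbf r,\mathbf h}(\alpha_{1,pq},\dots,\alpha_{pq-1,pq})=q\,\mathsf S_0(\mathbf r,\mathbf h)-2^H,$$ $$T^{(pq;q)}_{\mathbf r,\mathbf h}(\alpha_{1,pq},\dots,\alpha_{pq-1,pq})=p\,\mathsf S_0(\mathbf r,\mathbf h)-2^H,$$ $$T^{(pq;1)}_{\mathbf r,\mathbf h}(\alpha_{1,pq},\dots,\alpha_{pq-1,pq})=\bigl((p-1)(q-1)-1\bigr)\mathsf S_0(\mathbf r,\mathbf h)+2^H.$$ Consequently, $$T^{(pq)}_{\mathbf r,\mathbf h}(\alpha_{1,pq},\dots,\alpha_{pq-1,pq})=pq\,\mathsf S_0(\mathbf r,\mathbf h)-2^H.$$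
   Context: A pattern $(\mathbf r,\mathbf h)$ consists of an integer $t\ge 1$, a tuple $\mathbf r=(r_1,\dots,r_t)$ of nonzero integers with $r_1=1$, and a tuple $\mathbf h=(h_1,\dots,h_t)$ of nonnegative integers. For $n\ge 2$ put $\Omega_n=\{1,\dots,n-1\}$ and $\alpha_{k,n}=\cos(2\pi k/n)$ for $k\in\Omega_n$. For an integer $r$ with $\gcd(r,n)=1$, let $\sigma_r:\Omega_n\to\Omega_n$ be the permutation determined by $\sigma_r(k)\equiv rk\pmod n$. For $d\mid n$, $d<n$, put $\mathcal O_d(n)=\{k\in\Omega_n:\gcd(k,n)=d\}$. When $\gcd(n,r_1\cdots r_t)=1$, define $$T^{(n)}_{\mathbf r,\mathbf h}(x_1,\dots,x_{n-1})=\sum_{k\in\Omega_n}\prod_{j=1}^t\bigl(2x_{\sigma_{r_j}(k)}\bigr)^{h_j},\qquad T^{(n;d)}_{\mathbf r,\mathbf h}(x_1,\dots,x_{n-1})=\sum_{k\in\mathcal O_d(n)}\prod_{j=1}^t\bigl(2x_{\sigma_{r_j}(k)}\bigr)^{h_j}.$$ $\mathsf S_0(\mathbf r,\mathbf h)$ denotes the constant coefficient (coefficient of $u^0$) of the Laurent polynomial $\prod_{j=1}^t(u^{r_j}+u^{ -r_j})^{h_j}$. -}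

module Defs where

open import Algebra.Apartness.Bundles using (HeytingField)
open import Algebra.Bundles using (CommutativeRing; Semiring)
open import Algebra.Bundles.Raw using (RawSemiring)
import Algebra.Definitions.RawSemiring as RawSemiringDefinitions
import Algebra.Properties.Ring as RingProperties
open import Data.Fin.Base using (Fin; zero; suc; toℕ; fromℕ<)
open import Data.Fin.Properties using (toℕ<n; toℕ-fromℕ<)
open import Data.Integer.Base as ℤ using (ℤ; +_; -[1+_]; 0ℤ; 1ℤ; ∣_∣)
open import Data.Integer.Coprimality using (Coprime)
open import Data.Integer.Divisibility using (_∣_)
open import Data.Integer.DivMod using (_%ℕ_; _/ℕ_; n%ℕd<d; a≡a%ℕn+[a/ℕn]*n)
import Data.Integer.Properties as ℤ
open import Data.List.Base as List using (List; []; _∷_; [_]; _++_; allFin; cartesianProductWith)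
open import Data.Nat.Base as ℕ using (ℕ; zero; suc; pred; NonZero; _!)
import Data.Nat.Coprimality as ℕ
import Data.Nat.Divisibility as ℕ
open import Data.Nat.GCD using (gcd)
open import Data.Nat.Primality using (Prime; prime⇒irreducible)
import Data.Nat.Properties as ℕ
open import Data.Product.Base using (∃-syntax; _×_; _,_; proj₁; proj₂)
open import Data.Sum.Base using (_⊎_; inj₁; inj₂; [_,_]′)
open import Data.Vec.Functional using (Vector)
open import Function.Base using (_∘_)
open import Function.Bundles using (_⇔_; module Equivalence)
open import Level using (Level; _⊔_) renaming (suc to lsuc)
open import Relation.Binary.Core using (Rel)
open import Relation.Binary.PropositionalEquality as ≡ using (_≡_; _≢_; cong)
open import Relation.Binary.Structures using (IsStrictPartialOrder)
open import Relation.Nullary.Decidable using (yes; no)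
open import Relation.Nullary.Negation using (¬_; contradiction)

private
  module ℕΣ = RawSemiringDefinitions ℕ.+-*-rawSemiring
  module ℤΠ = RawSemiringDefinitions ℤ.+-*-rawSemiring

-- The real numbers are a Cauchy-complete Archimedean ordered field.  The
-- axioms are stated constructively (apartness instead of trichotomy); with
-- excluded middle they characterise ℝ up to unique isomorphism.

record RealNumbers c ℓ₁ ℓ₂ ℓ₃ : Set (lsuc (c ⊔ ℓ₁ ⊔ ℓ₂ ⊔ ℓ₃)) where
  infix 4 _<_
  field
    heytingField : HeytingField c ℓ₁ ℓ₂

  open HeytingField heytingField public

  commutativeRing : CommutativeRing c ℓ₁
  commutativeRing = record { isCommutativeRing = isCommutativeRing }

  open RawSemiringDefinitions (Semiring.rawSemiring (CommutativeRing.semiring commutativeRing)) public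
    using (_^_; product) renaming (_×_ to _·_)

  fromℕ : ℕ → Carrier
  fromℕ n = n · 1#

  field
    _<_                  : Rel Carrier ℓ₃
    isStrictPartialOrder : IsStrictPartialOrder _≈_ _<_
    #⇔<⊎>                : ∀ {x y} → x # y ⇔ (x < y ⊎ y < x)
    +-monoˡ-<            : ∀ z {x y} → x < y → x + z < y + z
    *-positive           : ∀ {x y} → 0# < x → 0# < y → 0# < x * y
    archimedean          : ∀ x → ∃[ n ] x < fromℕ n

  -- Both definitions avoid the absolute value: the first bounds aₘ - aₙ for
  -- all m and n, hence also aₙ - aₘ.
  IsCauchy : (ℕ → Carrier) → Set _
  IsCauchy a = ∀ ε → 0# < ε → ∃[ N ] ∀ m n → N ℕ.≤ m → N ℕ.≤ n → a m - a n < ε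

  _ConvergesTo_ : (ℕ → Carrier) → Carrier → Set _
  a ConvergesTo l = ∀ ε → 0# < ε → ∃[ N ] ∀ n → N ℕ.≤ n → (a n - l < ε) × (l - a n < ε)

  field
    complete : ∀ a → IsCauchy a → ∃[ l ] a ConvergesTo l

  fromℤ : ℤ → Carrier
  fromℤ (+ n)    = fromℕ n
  fromℤ -[1+ n ] = - fromℕ (suc n)

  private
    module < = IsStrictPartialOrder isStrictPartialOrder
    module R = RingProperties (CommutativeRing.ring commutativeRing)

  0<1 : 0# < 1#
  0<1 = [ 1<0⇒0<1 , (λ 0<1 → 0<1) ]′ (Equivalence.to #⇔<⊎> 1#0)
    where
    1-0≈1 : 1# - 0# ≈ 1#
    1-0≈1 = trans (+-congˡ R.-0#≈0#) (+-identityʳ 1#)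
    1#0 : 1# # 0#
    1#0 = invertible⇒# (1# , trans (*-identityˡ _) 1-0≈1 , trans (*-identityʳ _) 1-0≈1)
    [-1]²≈1 : (- 1#) * (- 1#) ≈ 1#
    [-1]²≈1 = trans (R.-1*x≈-x (- 1#)) (R.-‿involutive 1#)
    1<0⇒0<1 : 1# < 0# → 0# < 1#
    1<0⇒0<1 1<0 = <.<-respʳ-≈ [-1]²≈1 (*-positive 0<-1 0<-1)
      where
      0<-1 : 0# < - 1#
      0<-1 = <.<-respʳ-≈ (+-identityˡ _) (<.<-respˡ-≈ (-‿inverseʳ 1#) (+-monoˡ-< (- 1#) 1<0))

  0<fromℕ : ∀ n .{{_ : NonZero n}} → 0# < fromℕ n
  0<fromℕ zero          = contradiction ≡.refl (ℕ.≢-nonZero⁻¹ 0)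
  0<fromℕ (suc zero)    = <.<-respʳ-≈ (sym (+-identityʳ 1#)) 0<1
  0<fromℕ (suc (suc n)) = <.trans (0<fromℕ (suc n))
    (<.<-respˡ-≈ (+-identityˡ _) (+-monoˡ-< (fromℕ (suc n)) 0<1))

  1/ : ∀ n .{{_ : NonZero n}} → Carrier
  1/ n = proj₁ (#⇒invertible (Equivalence.from #⇔<⊎> (inj₂ (0<fromℕ n))))

module _ {c ℓ₁ ℓ₂ ℓ₃} (R : RealNumbers c ℓ₁ ℓ₂ ℓ₃) where
  open RealNumbers R

  cosPartialSum : Carrier → ℕ → Carrier
  cosPartialSum x zero    = 0#
  cosPartialSum x (suc N) =
    cosPartialSum x N + ((- 1#) ^ N * x ^ (2 ℕ.* N)) * 1/ ((2 ℕ.* N) !) {{(2 ℕ.* N) ℕ.!≢0}}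

  IsCosine : (Carrier → Carrier) → Set _
  IsCosine cos = ∀ x → cosPartialSum x ConvergesTo cos x

  -- π / 2 is the least positive zero of the cosine.
  record IsPi (cos : Carrier → Carrier) (π : Carrier) : Set (c ⊔ ℓ₁ ⊔ ℓ₃) where
    field
      0<π       : 0# < π
      cos[π/2]  : cos (π * 1/ 2) ≈ 0#
      π/2-least : ∀ x → 0# < x → x < π * 1/ 2 → ¬ (cos x ≈ 0#)

-- The tuples 𝐫 and 𝐡 are indexed by Fin t, so that r₁ is r zero.
record Pattern : Set where
  field
    t-1 : ℕ
  t : ℕ
  t = suc t-1
  field
    r    : Vector ℤ t
    h    : Vector ℕ t
    r≢0  : ∀ j → r j ≢ 0ℤ
    r₁≡1 : r zero ≡ 1ℤ

  ∏r : ℤ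
  ∏r = ℤΠ.product r

  H : ℕ
  H = ℕΣ.sum h

  B : ℕ
  B = ℕΣ.sum (λ j → h j ℕ.* ∣ r j ∣)

-- A Laurent polynomial in u is a formal sum of terms (e , a), standing for a uᵉ;
-- exponents may repeat, so only `coefficient` is meaningful.
Laurent : Set
Laurent = List (ℤ × ℤ)

coefficient : ℤ → Laurent → ℤ
coefficient e []             = 0ℤ
coefficient e ((e′ , a) ∷ f) with e′ ℤ.≟ e
... | yes _ = a ℤ.+ coefficient e f
... | no  _ = coefficient e f

laurentRawSemiring : RawSemiring _ _
laurentRawSemiring = record
  { Carrier = Laurent
  ; _≈_     = λ f g → ∀ e → coefficient e f ≡ coefficient e g
  ; _+_     = _++_
  ; _*_     = cartesianProductWith (λ (e , a) (e′ , b) → e ℤ.+ e′ , a ℤ.* b)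
  ; 0#      = []
  ; 1#      = [ 0ℤ , 1ℤ ]
  }

u^_ : ℤ → Laurent
u^ e = [ e , 1ℤ ]

S₀ : Pattern → ℤ
S₀ P = coefficient 0ℤ (product (λ j → (u^ r j + u^ (ℤ.- r j)) ^ h j))
  where
  open Pattern P
  open RawSemiring laurentRawSemiring using (_+_)
  open RawSemiringDefinitions laurentRawSemiring using (_^_; product)

-- Ωₙ = {1, …, n - 1}: the element k of Fin (n - 1) stands for k + 1.
Ω : ℕ → Set
Ω n = Fin (pred n)

⟦_⟧ : ∀ {m} → Fin m → ℕ
⟦ k ⟧ = suc (toℕ k)

⟦⟧<n : ∀ n (k : Ω n) → ⟦ k ⟧ ℕ.< n
⟦⟧<n (suc _) k = ℕ.s≤s (toℕ<n k)

nonZero : ∀ n → Ω n → NonZero n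
nonZero (suc _) _ = _

residue : ∀ n → ℤ → Ω n → ℕ
residue n r k = _%ℕ_ (r ℤ.* + ⟦ k ⟧) n {{nonZero n k}}

residue≢0 : ∀ n r → Coprime r (+ n) → (k : Ω n) → NonZero (residue n r k)
residue≢0 n r r⊥n k = ℕ.≢-nonZero λ residue≡0 → ℕ.>⇒∤ (⟦⟧<n n k) (n∣k residue≡0)
  where
  instance _ = nonZero n k
  rk = r ℤ.* + ⟦ k ⟧
  n∣rk : residue n r k ≡ 0 → n ℕ.∣ ∣ rk ∣
  n∣rk eq = ℕ.divides ∣ rk /ℕ n ∣ (≡.trans (cong ∣_∣ rk≡) (ℤ.abs-* (rk /ℕ n) (+ n)))
    where
    rk≡ : rk ≡ (rk /ℕ n) ℤ.* + n
    rk≡ = ≡.trans (a≡a%ℕn+[a/ℕn]*n rk n)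
            (≡.trans (cong (λ m → + m ℤ.+ (rk /ℕ n) ℤ.* + n) eq) (ℤ.+-identityˡ _))
  n∣k : residue n r k ≡ 0 → n ℕ.∣ ⟦ k ⟧
  n∣k eq = ℕ.coprime-divisor {n} {∣ r ∣} (λ (d∣n , d∣r) → r⊥n (d∣r , d∣n))
    (≡.subst (n ℕ.∣_) (ℤ.abs-* r (+ ⟦ k ⟧)) (n∣rk eq))

σ : ∀ n r → Coprime r (+ n) → Ω n → Ω n
σ n r r⊥n k =
  fromℕ< (ℕ.pred-mono-< {{residue≢0 n r r⊥n k}} (n%ℕd<d (r ℤ.* + ⟦ k ⟧) n {{nonZero n k}}))

⟦σ⟧ : ∀ n r (r⊥n : Coprime r (+ n)) (k : Ω n) → ⟦ σ n r r⊥n k ⟧ ≡ residue n r k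
⟦σ⟧ n r r⊥n k =
  ≡.trans (cong suc (toℕ-fromℕ< _)) (ℕ.suc-pred (residue n r k) {{residue≢0 n r r⊥n k}})

𝒪 : ℕ → (n : ℕ) → List (Ω n)
𝒪 d n = List.filter (λ k → gcd ⟦ k ⟧ n ℕ.≟ d) (allFin (pred n))

∣product : ∀ {t} (r : Vector ℤ t) j → r j ∣ ℤΠ.product r
∣product {suc _} r zero    = ≡.subst (∣ r zero ∣ ℕ.∣_)
  (≡.sym (ℤ.abs-* (r zero) (ℤΠ.product (r ∘ suc)))) (ℕ.m∣m*n _)
∣product {suc _} r (suc j) = ≡.subst (∣ r (suc j) ∣ ℕ.∣_)
  (≡.sym (ℤ.abs-* (r zero) (ℤΠ.product (r ∘ suc)))) (ℕ.∣n⇒∣m*n ∣ r zero ∣ (∣product (r ∘ suc) j))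

coprime-factor : ∀ P n → Coprime (+ n) (Pattern.∏r P) → ∀ j → Coprime (Pattern.r P j) (+ n)
coprime-factor P n n⊥∏r j (d∣r , d∣n) = n⊥∏r (d∣n , ℕ.∣-trans d∣r (∣product (Pattern.r P) j))

prime-coprime : ∀ {p m} → Prime p → ¬ (p ℕ.∣ m) → ℕ.Coprime p m
prime-coprime pr p∤m (d∣p , d∣m) with prime⇒irreducible pr d∣p
... | inj₁ d≡1    = d≡1
... | inj₂ ≡.refl = contradiction d∣m p∤m

pq-coprime : ∀ p q s → Prime p → Prime q → ¬ (+ p ∣ s) → ¬ (+ q ∣ s) → Coprime (+ (p ℕ.* q)) s
pq-coprime p q s p-prime q-prime p∤s q∤s {d} (d∣pq , d∣s) =
  prime-coprime q-prime q∤s (ℕ.coprime-divisor d⊥p d∣pq , d∣s)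
  where
  d⊥p : ℕ.Coprime d p
  d⊥p (e∣d , e∣p) = prime-coprime p-prime p∤s (e∣p , ℕ.∣-trans e∣d d∣s)

module _ {c ℓ₁ ℓ₂ ℓ₃} (R : RealNumbers c ℓ₁ ℓ₂ ℓ₃) where
  open RealNumbers R

  ∑ : ∀ {a} {A : Set a} → List A → (A → Carrier) → Carrier
  ∑ ks f = List.foldr _+_ 0# (List.map f ks)

  module _ (P : Pattern) (n : ℕ) (n⊥∏r : Coprime (+ n) (Pattern.∏r P)) where
    open Pattern P

    term : (Ω n → Carrier) → Ω n → Carrier
    term x k = product (λ j → (fromℕ 2 * x (σ n (r j) (coprime-factor P n n⊥∏r j) k)) ^ h j)

    T : (Ω n → Carrier) → Carrier
    T x = ∑ (allFin (pred n)) (term x)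

    T[_] : ℕ → (Ω n → Carrier) → Carrier
    T[ d ] x = ∑ (𝒪 d n) (term x)

  α : (Carrier → Carrier) → Carrier → (n : ℕ) → Ω n → Carrier
  α cos π n k = cos ((fromℕ 2 * π * fromℕ ⟦ k ⟧) * 1/ n {{nonZero n k}})

{-# OPTIONS --safe #-}
module Submission where

-- The Cauchy product of two cosine series gives d'Alembert's equation
-- f (x + y) + f (x - y) = 2 f x f y for f = cos.  Hence the operator with
-- symbol (u^r + u^-r)^h, where u acts as the translation by y, has f as an
-- eigenfunction with eigenvalue (2 f (r y))^h, and the summands of T are the
-- values at 0 of the Laurent polynomial of the pattern applied to f.  Summing
-- over all multiples y = k ω of ω = 2π / N leaves N S₀: for e ≠ 0 coprime to N
-- the sum of the f (k e ω) vanishes unless f (e ω) = 1, and then the equation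
-- makes e ω, thus ω, a period of f, which contradicts the minimality of the
-- zero π / 2.  The exponents are at most B in absolute value, hence N can be p,
-- q or p q.  The multiples of p among the residues mod p q give the case N = q,
-- with the residue 0 contributing 2^H, and likewise for q; the residues coprime
-- to p q are the rest.

open import Defs
open import Algebra.Bundles using (CommutativeRing)
open import Algebra.Bundles.Raw using (RawSemiring)
import Algebra.Definitions.RawSemiring as RawSemiringDefinitions
import Algebra.Properties.CommutativeSemigroup as CommutativeSemigroupProperties
import Algebra.Properties.Ring as RingProperties
import Algebra.Properties.Semiring.Mult as SemiringMult
import Algebra.Solver.Ring as RingSolver
open import Algebra.Solver.Ring.AlmostCommutativeRing
  using (fromCommutativeRing; _-Raw-AlmostCommutative⟶_; Induced-equivalence)
open import Data.Bool.Base using (true; false; if_then_else_)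
open import Data.Fin.Base using (Fin; zero; suc; toℕ)
open import Data.Integer.Base as ℤ using (ℤ; +_; -[1+_]; 0ℤ; 1ℤ)
import Data.Integer.Coprimality as ℤ
open import Data.Integer.Divisibility using (_∣_)
open import Data.Integer.DivMod using (_/ℕ_; a≡a%ℕn+[a/ℕn]*n)
import Data.Integer.Properties as ℤ
open import Data.List.Base using (List; []; _∷_; _++_; allFin; filter; map; tabulate)
open import Data.List.Relation.Unary.All as All using (All; []; _∷_)
import Data.List.Relation.Unary.All.Properties as All
open import Data.Maybe.Base using (just; nothing)
open import Data.Nat.Base as ℕ using (ℕ; zero; suc; NonZero; _!)
open import Data.Nat.Coprimality as ℕ
  using (Coprime; coprime-Bézout; coprime-divisor; coprime⇒gcd≡1; prime⇒coprime)
import Data.Nat.Divisibility as ℕ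
open import Data.Nat.GCD
  using (gcd; gcd[m,n]∣m; gcd[m,n]∣n; c*gcd[m,n]≡gcd[cm,cn]; gcd-identityˡ; module Bézout)
open import Data.Nat.Primality using (Prime; prime⇒irreducible; prime⇒nonZero; prime⇒nonTrivial)
import Data.Nat.Properties as ℕ
open import Data.Product.Base using (∃-syntax; _×_; _,_; proj₁; proj₂)
open import Data.Sum.Base using (_⊎_; inj₁; inj₂)
open import Data.Vec.Functional using (Vector)
open import Function.Base using (_∘_)
open import Function.Bundles using (module Equivalence)
open import Level using (_⊔_)
open import Relation.Binary.Definitions using (WeaklyDecidable)
open import Relation.Binary.PropositionalEquality as ≡ using (_≡_; _≢_; cong)
import Relation.Binary.Reasoning.Setoid as SetoidReasoning
open import Relation.Binary.Structures using (IsStrictPartialOrder)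
open import Relation.Nullary.Decidable using (Dec; yes; no; does)
open import Relation.Nullary.Negation using (¬_; contradiction)
open import Relation.Unary using (Decidable)

-- Natural numbers

-- Working with the cosine alone keeps everything in the reals: d'Alembert's equation takes the
-- place of the complex exponential and of the addition formulas that involve the sine. Once it is
-- established, the argument uses only this equation, the value 1 at 0, compatibility with `≈`, and
-- the least positive zero. The order is constructive: the sign of a number is not decided.
-- Estimates are therefore pairs of negated strict inequalities, and equations are reached through
-- tightness, since numbers that are not apart are equal. A limit enters as a null sequence that
-- turns out to be constant, hence zero. There is a single analytic estimate. The product of two
-- partial sums of length N contains the entries i, j < N with i + j >= N that the Cauchy product
-- misses. The terms of the series are O(8^-n), so these at most N² entries together are O(N² /
-- 8^N), and the cubic bound n³ <= 8^n leaves one factor N to spare, which forces the error to 0.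

n≤2^n : ∀ n → n ℕ.≤ 2 ℕ.^ n
n≤2^n zero    = ℕ.z≤n
n≤2^n (suc n) = ℕ.+-mono-≤ (ℕ.m^n>0 2 n) (ℕ.≤-trans (n≤2^n n) (ℕ.m≤m+n _ 0))

n³≤8^n : ∀ n → n ℕ.* (n ℕ.* n) ℕ.≤ 8 ℕ.^ n
n³≤8^n n = ℕ.≤-trans (ℕ.*-mono-≤ (n≤2^n n) (ℕ.*-mono-≤ (n≤2^n n) (n≤2^n n))) (ℕ.≤-reflexive (≡.sym 8^n≡))
  where
  8^n≡ : 8 ℕ.^ n ≡ 2 ℕ.^ n ℕ.* (2 ℕ.^ n ℕ.* 2 ℕ.^ n)
  8^n≡ = ≡.trans (ℕ.^-*-assoc 2 3 n)
    (≡.trans (ℕ.^-distribˡ-+-* 2 n (n ℕ.+ (n ℕ.+ 0)))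
      (cong (2 ℕ.^ n ℕ.*_) (≡.trans (cong (λ m → 2 ℕ.^ (n ℕ.+ m)) (ℕ.+-identityʳ n)) (ℕ.^-distribˡ-+-* 2 n n))))

-- While n <= a, the power is at most `a ^ a`; from then on each further factor a on the left is met
-- by a factor of the factorial that is at least a.
a^n≤a^a*n! : ∀ a .{{_ : NonZero a}} n → a ℕ.^ n ℕ.≤ a ℕ.^ a ℕ.* n !
a^n≤a^a*n! a zero = ℕ.≤-trans (ℕ.m^n>0 a a) (ℕ.m≤m*n _ 1)
a^n≤a^a*n! a (suc n) with a ℕ.≤? suc n
... | yes a≤1+n = ℕ.≤-trans (ℕ.*-mono-≤ a≤1+n (a^n≤a^a*n! a n)) (ℕ.≤-reflexive
        (≡.trans (≡.sym (ℕ.*-assoc (suc n) (a ℕ.^ a) (n !)))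
          (≡.trans (cong (ℕ._* n !) (ℕ.*-comm (suc n) (a ℕ.^ a))) (ℕ.*-assoc (a ℕ.^ a) (suc n) (n !)))))
... | no a≰1+n = ℕ.≤-trans (ℕ.^-monoʳ-≤ a (ℕ.<⇒≤ (ℕ.≰⇒> a≰1+n))) (ℕ.m≤m*n _ (suc n !) {{(suc n) ℕ.!≢0}})

2≤prime : ∀ {p} → Prime p → 2 ℕ.≤ p
2≤prime {p} p-prime = ℕ.nonTrivial⇒n>1 p {{prime⇒nonTrivial p-prime}}

gcd[l*b,a*b]≡b : ∀ {a} b {l} .{{_ : NonZero l}} → Prime a → l ℕ.< a → gcd (l ℕ.* b) (a ℕ.* b) ≡ b
gcd[l*b,a*b]≡b {a} b {l} a-prime l<a =
  ≡.trans (≡.cong₂ gcd (ℕ.*-comm l b) (ℕ.*-comm a b))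
    (≡.trans (≡.sym (c*gcd[m,n]≡gcd[cm,cn] b l a))
      (≡.trans (cong (b ℕ.*_) (coprime⇒gcd≡1 (ℕ.sym (prime⇒coprime a-prime l<a)))) (ℕ.*-identityʳ b)))

gcd[l*b+j,n]≢b : ∀ b l j n .{{_ : NonZero j}} → j ℕ.< b → gcd (l ℕ.* b ℕ.+ j) n ≢ b
gcd[l*b+j,n]≢b b l j n j<b gcd≡b = ℕ.>⇒∤ j<b (ℕ.∣m+n∣m⇒∣n {n = j}
  (≡.subst (ℕ._∣ l ℕ.* b ℕ.+ j) gcd≡b (gcd[m,n]∣m (l ℕ.* b ℕ.+ j) n)) (ℕ.n∣m*n l))

∣p*q⇒ : ∀ {p q d} → Prime p → Prime q → d ℕ.∣ p ℕ.* q → (d ≡ 1 ⊎ d ≡ p) ⊎ (d ≡ q ⊎ d ≡ p ℕ.* q)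
∣p*q⇒ {p} {q} {d} p-prime q-prime d∣pq with p ℕ.∣? d
... | no p∤d with prime⇒irreducible q-prime (coprime-divisor (ℕ.sym (prime-coprime p-prime p∤d)) d∣pq)
...   | inj₁ d≡1 = inj₁ (inj₁ d≡1)
...   | inj₂ d≡q = inj₂ (inj₁ d≡q)
∣p*q⇒ {p} {q} p-prime q-prime d∣pq | yes (ℕ.divides e ≡.refl)
  with prime⇒irreducible q-prime {e} (ℕ.*-cancelˡ-∣ p {{prime⇒nonZero p-prime}}
      (≡.subst (ℕ._∣ p ℕ.* q) (ℕ.*-comm e p) d∣pq))
... | inj₁ ≡.refl = inj₁ (inj₂ (ℕ.*-identityˡ p))
... | inj₂ ≡.refl = inj₂ (inj₂ (ℕ.*-comm q p))

gcd[k,p*q] : ∀ {p q} k .{{_ : NonZero k}} → Prime p → Prime q → k ℕ.< p ℕ.* q →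
  (gcd k (p ℕ.* q) ≡ 1 ⊎ gcd k (p ℕ.* q) ≡ p) ⊎ gcd k (p ℕ.* q) ≡ q
gcd[k,p*q] {p} {q} k p-prime q-prime k<pq with ∣p*q⇒ p-prime q-prime (gcd[m,n]∣n k (p ℕ.* q))
... | inj₁ 1⊎p           = inj₁ 1⊎p
... | inj₂ (inj₁ gcd≡q)  = inj₂ gcd≡q
... | inj₂ (inj₂ gcd≡pq) = contradiction (≡.subst (ℕ._∣ k) gcd≡pq (gcd[m,n]∣m k (p ℕ.* q))) (ℕ.>⇒∤ k<pq)

coprime-<prime : ∀ {p} e → Prime p → e ≢ 0ℤ → ℤ.∣ e ∣ ℕ.< p → Coprime ℤ.∣ e ∣ p
coprime-<prime e p-prime e≢0 ∣e∣<p =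
  ℕ.sym (prime⇒coprime p-prime {{ℕ.≢-nonZero (e≢0 ∘ ℤ.∣i∣≡0⇒i≡0)}} ∣e∣<p)

coprime-<primes : ∀ {p q} e → Prime p → Prime q → e ≢ 0ℤ → ℤ.∣ e ∣ ℕ.< p → ℤ.∣ e ∣ ℕ.< q →
  Coprime ℤ.∣ e ∣ (p ℕ.* q)
coprime-<primes {p} {q} e p-prime q-prime e≢0 ∣e∣<p ∣e∣<q =
  ℕ.sym (pq-coprime p q e p-prime q-prime (ℕ.>⇒∤ ∣e∣<p) (ℕ.>⇒∤ ∣e∣<q))
  where instance _ = ℕ.≢-nonZero (e≢0 ∘ ℤ.∣i∣≡0⇒i≡0)

-- Laurent polynomials

private
  module L = RawSemiring laurentRawSemiring
  module LΠ = RawSemiringDefinitions laurentRawSemiring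
  module ℕΣ = RawSemiringDefinitions ℕ.+-*-rawSemiring

coefficient-≡ : ∀ e a L → coefficient e ((e , a) ∷ L) ≡ a ℤ.+ coefficient e L
coefficient-≡ e a L with e ℤ.≟ e
... | yes _  = ≡.refl
... | no e≢e = contradiction ≡.refl e≢e

coefficient-≢ : ∀ {e e′} a L → e′ ≢ e → coefficient e ((e′ , a) ∷ L) ≡ coefficient e L
coefficient-≢ {e} {e′} a L e′≢e with e′ ℤ.≟ e
... | yes e′≡e = contradiction e′≡e e′≢e
... | no _     = ≡.refl

-- A property of the list and not of the polynomial it represents: terms that cancel or have
-- coefficient 0 are bounded too. This is harmless, as the bound is only needed for polynomials
-- built from the generators.
HasDegree≤ : ℕ → Laurent → Set
HasDegree≤ b = All (λ (e , _) → ℤ.∣ e ∣ ℕ.≤ b)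

hasDegree≤-* : ∀ {b d L M} → HasDegree≤ b L → HasDegree≤ d M → HasDegree≤ (b ℕ.+ d) (L L.* M)
hasDegree≤-* []                        _   = []
hasDegree≤-* {L = (e , _) ∷ _} (e≤b ∷ L≤b) M≤d = All.++⁺
  (All.map⁺ (All.map (λ {(e′ , _)} e′≤d → ℕ.≤-trans (ℤ.∣i+j∣≤∣i∣+∣j∣ e e′) (ℕ.+-mono-≤ e≤b e′≤d)) M≤d))
  (hasDegree≤-* L≤b M≤d)

hasDegree≤-^ : ∀ {b L} n → HasDegree≤ b L → HasDegree≤ (n ℕ.* b) (L LΠ.^ n)
hasDegree≤-^ zero    L≤b = ℕ.z≤n ∷ []
hasDegree≤-^ (suc n) L≤b = hasDegree≤-* L≤b (hasDegree≤-^ n L≤b)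

hasDegree≤-product : ∀ {t} {b : Vector ℕ t} {L : Vector Laurent t} →
  (∀ j → HasDegree≤ (b j) (L j)) → HasDegree≤ (ℕΣ.sum b) (LΠ.product L)
hasDegree≤-product {zero}  L≤b = ℕ.z≤n ∷ []
hasDegree≤-product {suc t} L≤b = hasDegree≤-* (L≤b zero) (hasDegree≤-product (λ j → L≤b (suc j)))

generator : ℤ → Laurent
generator r = (u^ r) L.+ (u^ (ℤ.- r))

hasDegree≤-generator : ∀ r → HasDegree≤ ℤ.∣ r ∣ (generator r)
hasDegree≤-generator r = ℕ.≤-refl ∷ ℕ.≤-reflexive (ℤ.∣-i∣≡∣i∣ r) ∷ []

module _ (P : Pattern) where
  open Pattern P

  generatingFactor : Vector Laurent t
  generatingFactor j = generator (r j) LΠ.^ h j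

  -- Unfolds to the very polynomial in the definition of `S₀`, so its coefficient at 0 is `S₀ P` by
  -- computation.
  generatingPolynomial : Laurent
  generatingPolynomial = LΠ.product generatingFactor

  hasDegree≤-generatingPolynomial : HasDegree≤ B generatingPolynomial
  hasDegree≤-generatingPolynomial = hasDegree≤-product {L = generatingFactor}
    (λ j → hasDegree≤-^ (h j) (hasDegree≤-generator (r j)))

module Reals {c ℓ₁ ℓ₂ ℓ₃} (R : RealNumbers c ℓ₁ ℓ₂ ℓ₃) where

  open RealNumbers R hiding (zero)

  private
    module CR = CommutativeRing commutativeRing
    module < = IsStrictPartialOrder isStrictPartialOrder
    module Mult = SemiringMult CR.semiring

  open RingProperties CR.ring
    using (-0#≈0#; -1*x≈-x; -‿+-comm; -‿distribˡ-*; -‿distribʳ-*; -‿involutive)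
  open CommutativeSemigroupProperties CR.*-commutativeSemigroup using (interchange; x∙yz≈y∙xz)
  open CommutativeSemigroupProperties CR.+-commutativeSemigroup using () renaming (interchange to +-interchange)
  open SetoidReasoning CR.setoid

  -- The integers inside the field, and a ring solver with integer coefficients

  fromℕ-+ : ∀ m n → fromℕ (m ℕ.+ n) ≈ fromℕ m + fromℕ n
  fromℕ-+ = Mult.×-homo-+ 1#

  fromℕ-* : ∀ m n → fromℕ (m ℕ.* n) ≈ fromℕ m * fromℕ n
  fromℕ-* = Mult.×1-homo-*

  fromℕ-1 : fromℕ 1 ≈ 1#
  fromℕ-1 = +-identityʳ 1#

  fromℤ-neg : ∀ i → fromℤ (ℤ.- i) ≈ - fromℤ i
  fromℤ-neg (+ zero)  = sym -0#≈0#
  fromℤ-neg (+ suc n) = refl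
  fromℤ-neg -[1+ n ]  = sym (-‿involutive _)

  -- Computed by hand, because the ring solver depends on `fromℤ-+`, which rests on this identity.
  [x+y]-[x+z]≈y-z : ∀ x y z → (x + y) - (x + z) ≈ y - z
  [x+y]-[x+z]≈y-z x y z = begin
    (x + y) - (x + z)         ≈⟨ +-cong (+-comm x y) (sym (-‿+-comm x z)) ⟩
    (y + x) + (- x + - z)     ≈⟨ +-assoc y x _ ⟩
    y + (x + (- x + - z))     ≈⟨ +-congˡ (sym (+-assoc x (- x) (- z))) ⟩
    y + ((x + - x) + - z)     ≈⟨ +-congˡ (trans (+-congʳ (-‿inverseʳ x)) (+-identityˡ _)) ⟩
    y - z                     ∎

  fromℤ-⊖ : ∀ m n → fromℤ (m ℤ.⊖ n) ≈ fromℕ m - fromℕ n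
  fromℤ-⊖ m zero = sym (trans (+-congˡ -0#≈0#) (+-identityʳ _))
  fromℤ-⊖ zero (suc n) = sym (+-identityˡ _)
  fromℤ-⊖ (suc m) (suc n) = begin
    fromℤ (suc m ℤ.⊖ suc n)       ≡⟨ cong fromℤ (ℤ.[1+m]⊖[1+n]≡m⊖n m n) ⟩
    fromℤ (m ℤ.⊖ n)               ≈⟨ fromℤ-⊖ m n ⟩
    fromℕ m - fromℕ n             ≈⟨ [x+y]-[x+z]≈y-z 1# _ _ ⟨
    fromℕ (suc m) - fromℕ (suc n) ∎

  fromℤ-+ : ∀ i j → fromℤ (i ℤ.+ j) ≈ fromℤ i + fromℤ j
  fromℤ-+ (+ m)    (+ n)    = fromℕ-+ m n
  fromℤ-+ (+ m)    -[1+ n ] = fromℤ-⊖ m (suc n)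
  fromℤ-+ -[1+ m ] (+ n)    = trans (fromℤ-⊖ n (suc m)) (+-comm _ _)
  fromℤ-+ -[1+ m ] -[1+ n ] = begin
    - fromℕ (suc (suc (m ℕ.+ n)))       ≡⟨ cong (λ k → - fromℕ (suc k)) (ℕ.+-suc m n) ⟨
    - fromℕ (suc m ℕ.+ suc n)           ≈⟨ -‿cong (fromℕ-+ (suc m) (suc n)) ⟩
    - (fromℕ (suc m) + fromℕ (suc n))   ≈⟨ -‿+-comm _ _ ⟨
    - fromℕ (suc m) - fromℕ (suc n)     ∎

  fromℤ-*-fromℕ : ∀ m j → fromℤ (+ m ℤ.* j) ≈ fromℕ m * fromℤ j
  fromℤ-*-fromℕ m (+ n) = trans (CR.reflexive (cong fromℤ (≡.sym (ℤ.pos-* m n)))) (fromℕ-* m n)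
  fromℤ-*-fromℕ m -[1+ n ] = begin
    fromℤ (+ m ℤ.* -[1+ n ])       ≡⟨ cong fromℤ (ℤ.neg-distribʳ-* (+ m) (+ suc n)) ⟨
    fromℤ (ℤ.- (+ m ℤ.* + suc n))  ≈⟨ fromℤ-neg (+ m ℤ.* + suc n) ⟩
    - fromℤ (+ m ℤ.* + suc n)      ≈⟨ -‿cong (fromℤ-*-fromℕ m (+ suc n)) ⟩
    - (fromℕ m * fromℕ (suc n))    ≈⟨ -‿distribʳ-* _ _ ⟩
    fromℕ m * - fromℕ (suc n)      ∎

  fromℤ-* : ∀ i j → fromℤ (i ℤ.* j) ≈ fromℤ i * fromℤ j
  fromℤ-* (+ m)    j = fromℤ-*-fromℕ m j
  fromℤ-* -[1+ m ] j = begin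
    fromℤ (-[1+ m ] ℤ.* j)         ≡⟨ cong fromℤ (ℤ.neg-distribˡ-* (+ suc m) j) ⟨
    fromℤ (ℤ.- (+ suc m ℤ.* j))    ≈⟨ fromℤ-neg (+ suc m ℤ.* j) ⟩
    - fromℤ (+ suc m ℤ.* j)        ≈⟨ -‿cong (fromℤ-*-fromℕ (suc m) j) ⟩
    - (fromℕ (suc m) * fromℤ j)    ≈⟨ -‿distribˡ-* _ _ ⟩
    - fromℕ (suc m) * fromℤ j      ∎

  private
    fromℤ-morphism : ℤ.+-*-rawRing -Raw-AlmostCommutative⟶ fromCommutativeRing commutativeRing
    fromℤ-morphism = record
      { ⟦_⟧    = fromℤ
      ; +-homo = fromℤ-+
      ; *-homo = fromℤ-*
      ; -‿homo = fromℤ-neg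
      ; 0-homo = refl
      ; 1-homo = fromℕ-1
      }

    _coefficient≟_ : WeaklyDecidable (Induced-equivalence fromℤ-morphism)
    i coefficient≟ j with i ℤ.≟ j
    ... | yes ≡.refl = just refl
    ... | no _       = nothing

  open RingSolver ℤ.+-*-rawRing (fromCommutativeRing commutativeRing) fromℤ-morphism _coefficient≟_
    using (solve; con; _:+_; _:*_; _:-_; :-_; _:=_)

  -- Ordered field

  -- Replaces trichotomy. Cotransitivity of apartness gives four cases, and the two in which `z`
  -- lies outside the interval follow by transitivity.
  <-cotrans : ∀ {x y} → x < y → ∀ z → x < z ⊎ z < y
  <-cotrans {x} {y} x<y z with #-cotrans (Equivalence.from #⇔<⊎> (inj₁ x<y)) z
  ... | inj₁ x#z with Equivalence.to #⇔<⊎> x#z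
  ...   | inj₁ x<z = inj₁ x<z
  ...   | inj₂ z<x = inj₂ (<.trans z<x x<y)
  <-cotrans {x} {y} x<y z | inj₂ z#y with Equivalence.to #⇔<⊎> z#y
  ...   | inj₁ z<y = inj₂ z<y
  ...   | inj₂ y<z = inj₁ (<.trans x<y y<z)

  <-resp-≈ : ∀ {x x′ y y′} → x ≈ x′ → y ≈ y′ → x < y → x′ < y′
  <-resp-≈ x≈x′ y≈y′ x<y = <.<-respˡ-≈ x≈x′ (<.<-respʳ-≈ y≈y′ x<y)

  x<y⇒0<y-x : ∀ {x y} → x < y → 0# < y - x
  x<y⇒0<y-x {x} x<y = <.<-respˡ-≈ (-‿inverseʳ x) (+-monoˡ-< (- x) x<y)

  0<y-x⇒x<y : ∀ {x y} → 0# < y - x → x < y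
  0<y-x⇒x<y {x} {y} 0<y-x = <-resp-≈ (+-identityˡ x)
    (solve 2 (λ x y → (y :- x) :+ x := y) refl x y) (+-monoˡ-< x 0<y-x)

  x<0⇒0<-x : ∀ {x} → x < 0# → 0# < - x
  x<0⇒0<-x x<0 = <.<-respʳ-≈ (+-identityˡ _) (x<y⇒0<y-x x<0)

  0<x⇒-x<0 : ∀ {x} → 0# < x → - x < 0#
  0<x⇒-x<0 {x} 0<x = <-resp-≈ (+-identityˡ _) (-‿inverseʳ x) (+-monoˡ-< (- x) 0<x)

  x<y⇒x-y<0 : ∀ {x y} → x < y → x - y < 0#
  x<y⇒x-y<0 {x} {y} x<y = <.<-respʳ-≈ (-‿inverseʳ y) (+-monoˡ-< (- y) x<y)

  unit⇒#0 : ∀ {x y} → x * y ≈ 1# → x # 0#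
  unit⇒#0 {x} {y} xy≈1 = invertible⇒#
    ( y
    , trans (solve 2 (λ x y → y :* (x :- con 0ℤ) := x :* y) refl x y) xy≈1
    , trans (solve 2 (λ x y → (x :- con 0ℤ) :* y := x :* y) refl x y) xy≈1
    )

  #0⇒unit : ∀ {x} → x # 0# → ∃[ y ] x * y ≈ 1#
  #0⇒unit {x} x#0 with #⇒invertible x#0
  ... | y , _ , [x-0]y≈1 = y , trans (solve 2 (λ x y → x :* y := (x :- con 0ℤ) :* y) refl x y) [x-0]y≈1

  0<⇒#0 : ∀ {x} → 0# < x → x # 0#
  0<⇒#0 0<x = Equivalence.from #⇔<⊎> (inj₂ 0<x)

  #0-*-cancel : ∀ {x y} → x # 0# → x * y ≈ 0# → y ≈ 0#
  #0-*-cancel {x} {y} x#0 xy≈0 with #0⇒unit x#0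
  ... | x⁻¹ , xx⁻¹≈1 = begin
    y               ≈⟨ *-identityˡ y ⟨
    1# * y          ≈⟨ *-congʳ xx⁻¹≈1 ⟨
    (x * x⁻¹) * y   ≈⟨ solve 3 (λ x i y → (x :* i) :* y := i :* (x :* y)) refl x x⁻¹ y ⟩
    x⁻¹ * (x * y)   ≈⟨ *-congˡ xy≈0 ⟩
    x⁻¹ * 0#        ≈⟨ zeroʳ _ ⟩
    0#              ∎

  -- Tightness makes equality a negative statement, so that equations may be proved by
  -- contradiction.
  ¬#⇒≈ : ∀ {x y} → ¬ (x # y) → x ≈ y
  ¬#⇒≈ {x} {y} = proj₁ (tight x y)

  ≈⇒¬# : ∀ {x y} → x ≈ y → ¬ (x # y)
  ≈⇒¬# {x} {y} = proj₂ (tight x y)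

  x-y≈0⇒x≈y : ∀ {x y} → x - y ≈ 0# → x ≈ y
  x-y≈0⇒x≈y {x} {y} x-y≈0 = begin
    x           ≈⟨ solve 2 (λ x y → x := (x :- y) :+ y) refl x y ⟩
    (x - y) + y ≈⟨ +-congʳ x-y≈0 ⟩
    0# + y      ≈⟨ +-identityˡ y ⟩
    y           ∎

  x≈y⇒x-y≈0 : ∀ {x y} → x ≈ y → x - y ≈ 0#
  x≈y⇒x-y≈0 {x} {y} x≈y = trans (+-congʳ x≈y) (-‿inverseʳ y)

  fromℕ#0 : ∀ n .{{_ : NonZero n}} → fromℕ n # 0#
  fromℕ#0 n = 0<⇒#0 (0<fromℕ n)

  fromℕ-*-cancel : ∀ n .{{_ : NonZero n}} {x y} → fromℕ n * x ≈ fromℕ n * y → x ≈ y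
  fromℕ-*-cancel n {x} {y} nx≈ny = x-y≈0⇒x≈y (#0-*-cancel (fromℕ#0 n) (begin
    fromℕ n * (x - y)
      ≈⟨ solve 3 (λ n x y → n :* (x :- y) := n :* x :- n :* y) refl (fromℕ n) x y ⟩
    fromℕ n * x - fromℕ n * y   ≈⟨ x≈y⇒x-y≈0 nx≈ny ⟩
    0#                          ∎))

  1/-inverse : ∀ n .{{_ : NonZero n}} → fromℕ n * 1/ n ≈ 1#
  1/-inverse n = trans (solve 2 (λ n i → n :* i := (n :- con 0ℤ) :* i) refl (fromℕ n) (1/ n))
    (proj₂ (proj₂ (#⇒invertible (Equivalence.from #⇔<⊎> (inj₂ (0<fromℕ n))))))

  positive*negative : ∀ {x y} → 0# < x → y < 0# → x * y < 0#
  positive*negative {x} {y} 0<x y<0 = <.<-respˡ-≈ -[x*-y]≈xy (0<x⇒-x<0 (*-positive 0<x (x<0⇒0<-x y<0)))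
    where
    -[x*-y]≈xy : - (x * - y) ≈ x * y
    -[x*-y]≈xy = trans (-‿distribʳ-* x (- y)) (*-congˡ (-‿involutive y))

  -- A positive product is invertible, hence so is `y`. This decides the sign of `y`, and the
  -- negative sign would make the product negative.
  positive-cancel : ∀ {x y} → 0# < x → 0# < x * y → 0# < y
  positive-cancel {x} {y} 0<x 0<xy with #0⇒unit (0<⇒#0 0<xy)
  ... | z , xyz≈1 with Equivalence.to #⇔<⊎> (unit⇒#0 {y} {x * z}
          (trans (trans (x∙yz≈y∙xz y x z) (sym (*-assoc x y z))) xyz≈1))
  ...   | inj₂ 0<y = 0<y
  ...   | inj₁ y<0 = contradiction 0<xy (<.asym (positive*negative 0<x y<0))

  0<1/ : ∀ n .{{_ : NonZero n}} → 0# < 1/ n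
  0<1/ n = positive-cancel (0<fromℕ n) (<.<-respʳ-≈ (sym (1/-inverse n)) 0<1)

  -- The weak order as a negation: a proof may assume the strict inequality and refute it, and no
  -- disjunction of < and ≈ is ever required.
  NonNegative : Carrier → Set ℓ₃
  NonNegative x = ¬ (x < 0#)

  nonNegative-resp : ∀ {x y} → x ≈ y → NonNegative x → NonNegative y
  nonNegative-resp x≈y x≮0 y<0 = x≮0 (<.<-respˡ-≈ (sym x≈y) y<0)

  positive⇒nonNegative : ∀ {x} → 0# < x → NonNegative x
  positive⇒nonNegative = <.asym

  0-nonNegative : NonNegative 0#
  0-nonNegative = <.irrefl refl

  +-nonNegative : ∀ {x y} → NonNegative x → NonNegative y → NonNegative (x + y)
  +-nonNegative {x} {y} 0≤x 0≤y x+y<0 with <-cotrans x+y<0 y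
  ... | inj₂ y<0   = 0≤y y<0
  ... | inj₁ x+y<y = 0≤x (<-resp-≈ (solve 2 (λ x y → (x :+ y) :- y := x) refl x y) (-‿inverseʳ y)
                       (+-monoˡ-< (- y) x+y<y))

  nonNegative∧#0⇒positive : ∀ {x} → NonNegative x → x # 0# → 0# < x
  nonNegative∧#0⇒positive 0≤x x#0 with Equivalence.to #⇔<⊎> x#0
  ... | inj₁ x<0 = contradiction x<0 0≤x
  ... | inj₂ 0<x = 0<x

  -- If the product were negative it would be invertible, and so would both factors; nonnegative and
  -- apart from 0, they would be positive, and so would the product.
  *-nonNegative : ∀ {x y} → NonNegative x → NonNegative y → NonNegative (x * y)
  *-nonNegative {x} {y} 0≤x 0≤y xy<0 with #0⇒unit (Equivalence.from #⇔<⊎> (inj₁ xy<0))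
  ... | z , xyz≈1 = <.asym xy<0 (*-positive
    (nonNegative∧#0⇒positive 0≤x (unit⇒#0 (trans (sym (*-assoc x y z)) xyz≈1)))
    (nonNegative∧#0⇒positive 0≤y (unit⇒#0
      (trans (trans (x∙yz≈y∙xz y x z) (sym (*-assoc x y z))) xyz≈1))))

  nonNegative-cancel : ∀ {x y} → 0# < x → NonNegative (x * y) → NonNegative y
  nonNegative-cancel 0<x 0≤xy y<0 = 0≤xy (positive*negative 0<x y<0)

  fromℕ-nonNegative : ∀ n → NonNegative (fromℕ n)
  fromℕ-nonNegative zero      = 0-nonNegative
  fromℕ-nonNegative n@(suc _) = positive⇒nonNegative (0<fromℕ n)

  fromℕ-∸ : ∀ {m n} → m ℕ.≤ n → fromℕ (n ℕ.∸ m) ≈ fromℕ n - fromℕ m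
  fromℕ-∸ {m} {n} m≤n = begin
    fromℕ (n ℕ.∸ m)
      ≈⟨ solve 2 (λ x y → y := (x :+ y) :- x) refl (fromℕ m) (fromℕ (n ℕ.∸ m)) ⟩
    (fromℕ m + fromℕ (n ℕ.∸ m)) - fromℕ m   ≈⟨ +-congʳ (fromℕ-+ m (n ℕ.∸ m)) ⟨
    fromℕ (m ℕ.+ (n ℕ.∸ m)) - fromℕ m       ≡⟨ cong (λ k → fromℕ k - fromℕ m) (ℕ.m+[n∸m]≡n m≤n) ⟩
    fromℕ n - fromℕ m                       ∎

  fromℕ-mono-≤ : ∀ {m n} → m ℕ.≤ n → NonNegative (fromℕ n - fromℕ m)
  fromℕ-mono-≤ {m} {n} m≤n = nonNegative-resp (fromℕ-∸ m≤n) (fromℕ-nonNegative (n ℕ.∸ m))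

  fromℕ-mono-< : ∀ {m n} → m ℕ.< n → fromℕ m < fromℕ n
  fromℕ-mono-< {m} {n} m<n = 0<y-x⇒x<y
    (<-resp-≈ refl (fromℕ-∸ (ℕ.<⇒≤ m<n)) (0<fromℕ (n ℕ.∸ m) {{ℕ.>-nonZero (ℕ.m<n⇒0<n∸m m<n)}}))

  -- Two-sided bounds

  infix 4 ∣_∣≤_

  -- Two one-sided bounds avoid the construction of an absolute value. As a record type it lets
  -- unification recover `x` and `K`, which the unfolded negations would hide.
  record ∣_∣≤_ (x K : Carrier) : Set ℓ₃ where
    constructor _,_
    field
      upper : NonNegative (K - x)
      lower : NonNegative (K + x)

  ∣∣≤-resp : ∀ {x y K L} → x ≈ y → K ≈ L → ∣ x ∣≤ K → ∣ y ∣≤ L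
  ∣∣≤-resp x≈y K≈L (u , l) =
    nonNegative-resp (+-cong K≈L (-‿cong x≈y)) u , nonNegative-resp (+-cong K≈L x≈y) l

  ∣∣≤-cong : ∀ {x y K} → x ≈ y → ∣ x ∣≤ K → ∣ y ∣≤ K
  ∣∣≤-cong x≈y = ∣∣≤-resp x≈y refl

  bound-nonNegative : ∀ {x K} → ∣ x ∣≤ K → NonNegative K
  bound-nonNegative {x} {K} (u , l) = nonNegative-cancel (0<fromℕ 2) (nonNegative-resp
    (solve 2 (λ x K → (K :- x) :+ (K :+ x) := con (+ 2) :* K) refl x K) (+-nonNegative u l))

  ∣∣≤-weaken : ∀ {x K L} → NonNegative (L - K) → ∣ x ∣≤ K → ∣ x ∣≤ L
  ∣∣≤-weaken {x} {K} {L} K≤L (u , l) =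
    nonNegative-resp (solve 3 (λ x K L → (L :- K) :+ (K :- x) := L :- x) refl x K L) (+-nonNegative K≤L u) ,
    nonNegative-resp (solve 3 (λ x K L → (L :- K) :+ (K :+ x) := L :+ x) refl x K L) (+-nonNegative K≤L l)

  nonNegative⇒∣x∣≤x : ∀ {x} → NonNegative x → ∣ x ∣≤ x
  nonNegative⇒∣x∣≤x {x} 0≤x = nonNegative-resp (sym (-‿inverseʳ x)) 0-nonNegative , +-nonNegative 0≤x 0≤x

  ∣0∣≤ : ∀ {K} → NonNegative K → ∣ 0# ∣≤ K
  ∣0∣≤ {K} 0≤K =
    nonNegative-resp (sym (trans (+-congˡ -0#≈0#) (+-identityʳ K))) 0≤K ,
    nonNegative-resp (sym (+-identityʳ K)) 0≤K

  ∣∣≤-+ : ∀ {x y K L} → ∣ x ∣≤ K → ∣ y ∣≤ L → ∣ x + y ∣≤ (K + L)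
  ∣∣≤-+ {x} {y} {K} {L} (u , l) (u′ , l′) =
    nonNegative-resp (solve 4 (λ x y K L → (K :- x) :+ (L :- y) := (K :+ L) :- (x :+ y)) refl x y K L)
        (+-nonNegative u u′) ,
    nonNegative-resp (solve 4 (λ x y K L → (K :+ x) :+ (L :+ y) := (K :+ L) :+ (x :+ y)) refl x y K L)
        (+-nonNegative l l′)

  ∣∣≤-neg : ∀ {x K} → ∣ x ∣≤ K → ∣ - x ∣≤ K
  ∣∣≤-neg {x} {K} (u , l) = nonNegative-resp (+-congˡ (sym (-‿involutive x))) l , u

  -- 2 (K L ∓ x y) = (K - x) (L ± y) + (K + x) (L ∓ y)
  ∣∣≤-* : ∀ {x y K L} → ∣ x ∣≤ K → ∣ y ∣≤ L → ∣ x * y ∣≤ (K * L)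
  ∣∣≤-* {x} {y} {K} {L} (u , l) (u′ , l′) =
    nonNegative-cancel (0<fromℕ 2) (nonNegative-resp
      (solve 4 (λ x y K L → (K :- x) :* (L :+ y) :+ (K :+ x) :* (L :- y) :=
          con (+ 2) :* (K :* L :- x :* y)) refl x y K L)
      (+-nonNegative (*-nonNegative u l′) (*-nonNegative l u′))) ,
    nonNegative-cancel (0<fromℕ 2) (nonNegative-resp
      (solve 4 (λ x y K L → (K :- x) :* (L :- y) :+ (K :+ x) :* (L :+ y) :=
          con (+ 2) :* (K :* L :+ x :* y)) refl x y K L)
      (+-nonNegative (*-nonNegative u u′) (*-nonNegative l l′)))

  ∣∣≤-cancel : ∀ {x y K} → 0# < x → ∣ x * y ∣≤ (x * K) → ∣ y ∣≤ K
  ∣∣≤-cancel {x} {y} {K} 0<x (u , l) =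
    nonNegative-cancel 0<x (nonNegative-resp (solve 3
        (λ x y K → x :* K :- x :* y := x :* (K :- y)) refl x y K) u) ,
    nonNegative-cancel 0<x (nonNegative-resp (solve 3
        (λ x y K → x :* K :+ x :* y := x :* (K :+ y)) refl x y K) l)

  ∣fromℕ∣≤ : ∀ n → ∣ fromℕ n ∣≤ fromℕ n
  ∣fromℕ∣≤ n = nonNegative⇒∣x∣≤x (fromℕ-nonNegative n)

  ∣1∣≤1 : ∣ 1# ∣≤ 1#
  ∣1∣≤1 = nonNegative⇒∣x∣≤x (positive⇒nonNegative 0<1)

  -- n |m x| = m |n x| <= m K <= n K, and n cancels.
  ∣∣≤-fromℕ-mono : ∀ {m n x K} → m ℕ.≤ n → ∣ fromℕ n * x ∣≤ K → ∣ fromℕ m * x ∣≤ K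
  ∣∣≤-fromℕ-mono {zero}  {n} {x} _   ∣nx∣≤K = ∣∣≤-cong (sym (zeroˡ x)) (∣0∣≤ (bound-nonNegative ∣nx∣≤K))
  ∣∣≤-fromℕ-mono {m@(suc _)} {n@(suc _)} {x} {K} m≤n ∣nx∣≤K = ∣∣≤-cancel (0<fromℕ n)
    (∣∣≤-weaken
      (nonNegative-resp (solve 3 (λ n m K → (n :- m) :* K := n :* K :- m :* K) refl (fromℕ n) (fromℕ m) K)
        (*-nonNegative (fromℕ-mono-≤ m≤n) (bound-nonNegative ∣nx∣≤K)))
      (∣∣≤-cong (solve 3 (λ n m x → m :* (n :* x) := n :* (m :* x)) refl (fromℕ n) (fromℕ m) x)
        (∣∣≤-* (∣fromℕ∣≤ m) ∣nx∣≤K)))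

  bounded : ∀ x → ∃[ n ] ∣ x ∣≤ fromℕ n
  bounded x with archimedean x | archimedean (- x)
  ... | m , x<m | n , -x<n = m ℕ.+ n ,
    ( nonNegative-resp (trans (solve 3 (λ x m n → (m :- x) :+ n := (m :+ n) :- x) refl x (fromℕ m)
        (fromℕ n)) (+-congʳ (sym (fromℕ-+ m n))))
        (+-nonNegative (positive⇒nonNegative (x<y⇒0<y-x x<m)) (fromℕ-nonNegative n))
    , nonNegative-resp (trans (solve 3 (λ x m n → m :+ (n :- (:- x)) := (m :+ n) :+ x) refl x (fromℕ m)
        (fromℕ n)) (+-congʳ (sym (fromℕ-+ m n))))
        (+-nonNegative (fromℕ-nonNegative m) (positive⇒nonNegative (x<y⇒0<y-x -x<n))) )

  -- Null sequences

  -- Quantifying over k : ℕ instead of ε > 0 keeps the closure properties free of divisions.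
  Null : (ℕ → Carrier) → Set _
  Null a = ∃[ K ] ∀ k → ∃[ N ] ∀ n → N ℕ.≤ n → ∣ fromℕ k * a n ∣≤ K

  null-cong : ∀ {a b} → (∀ n → a n ≈ b n) → Null a → Null b
  null-cong a≈b (K , small) = K , λ k → proj₁ (small k) , λ n N≤n → ∣∣≤-cong (*-congˡ (a≈b n))
      (proj₂ (small k) n N≤n)

  null-tail : ∀ {a} → Null a → Null (λ n → a (suc n))
  null-tail (K , small) = K , λ k → proj₁ (small k) , λ n N≤n → proj₂ (small k) (suc n) (ℕ.m≤n⇒m≤1+n N≤n)

  null-+ : ∀ {a b} → Null a → Null b → Null (λ n → a n + b n)
  null-+ (K , small) (L , small′) = K + L , λ k →
    proj₁ (small k) ℕ.⊔ proj₁ (small′ k) , λ n N≤n →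
      ∣∣≤-cong (sym (distribˡ _ _ _)) (∣∣≤-+
        (proj₂ (small k) n (ℕ.m⊔n≤o⇒m≤o _ _ N≤n)) (proj₂ (small′ k) n (ℕ.m⊔n≤o⇒n≤o _ _ N≤n)))

  null-* : ∀ {a b} → Null a → Null b → Null (λ n → a n * b n)
  null-* (K , small) (L , small′) = K * L , λ k →
    -- The first factor carries the whole scale k. Of the second only a bound is wanted, which is
    -- its estimate at scale 1.
    proj₁ (small k) ℕ.⊔ proj₁ (small′ 1) , λ n N≤n →
      ∣∣≤-cong (trans (*-congˡ (trans (*-congʳ fromℕ-1) (*-identityˡ _))) (*-assoc _ _ _)) (∣∣≤-*
        (proj₂ (small k) n (ℕ.m⊔n≤o⇒m≤o _ _ N≤n)) (proj₂ (small′ 1) n (ℕ.m⊔n≤o⇒n≤o _ _ N≤n)))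

  ∣∣≤-*-swap : ∀ {x y z K L} → ∣ x ∣≤ K → ∣ y * z ∣≤ L → ∣ y * (x * z) ∣≤ (K * L)
  ∣∣≤-*-swap {x} {y} {z} ∣x∣≤K ∣yz∣≤L = ∣∣≤-cong (x∙yz≈y∙xz x y z) (∣∣≤-* ∣x∣≤K ∣yz∣≤L)

  null-scale : ∀ c {a} → Null a → Null (λ n → c * a n)
  null-scale c (K , small) = fromℕ (proj₁ (bounded c)) * K , λ k →
    proj₁ (small k) , λ n N≤n → ∣∣≤-*-swap (proj₂ (bounded c)) (proj₂ (small k) n N≤n)

  null-neg : ∀ {a} → Null a → Null (λ n → - a n)
  null-neg (K , small) = K , λ k → proj₁ (small k) , λ n N≤n →
    ∣∣≤-cong (-‿distribʳ-* _ _) (∣∣≤-neg (proj₂ (small k) n N≤n))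

  x-[y-z]≈x+[z-y] : ∀ x y z → x - (y - z) ≈ x + (z - y)
  x-[y-z]≈x+[z-y] = solve 3 (λ x y z → x :- (y :- z) := x :+ (z :- y)) refl

  ∣∣≤-between : ∀ {x y ε} → x - y < ε → y - x < ε → ∣ x - y ∣≤ ε
  ∣∣≤-between {x} {y} {ε} x-y<ε y-x<ε =
    positive⇒nonNegative (x<y⇒0<y-x x-y<ε) ,
    nonNegative-resp (x-[y-z]≈x+[z-y] ε y x) (positive⇒nonNegative (x<y⇒0<y-x y-x<ε))

  ∣∣≤-scale : ∀ {k x ε L} → ∣ k ∣≤ k → k * ε ≈ L → ∣ x ∣≤ ε → ∣ k * x ∣≤ L
  ∣∣≤-scale ∣k∣≤k kε≈L ∣x∣≤ε = ∣∣≤-resp refl kε≈L (∣∣≤-* ∣k∣≤k ∣x∣≤ε)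

  convergesTo⇒null : ∀ {a l} → a ConvergesTo l → Null (λ n → a n - l)
  convergesTo⇒null {a} {l} a→l = 1# , small
    where
    small : ∀ k → ∃[ N ] ∀ n → N ℕ.≤ n → ∣ fromℕ k * (a n - l) ∣≤ 1#
    small zero = 0 , λ n _ → ∣∣≤-cong (sym (zeroˡ _)) (∣0∣≤ (positive⇒nonNegative 0<1))
    -- For ε = 1 / (k + 1) the scaled error is at most 1, one bound for all k. Scale 0 is separate
    -- because 0 has no inverse.
    small (suc k) = proj₁ N,close , λ n N≤n → ∣∣≤-scale (∣fromℕ∣≤ (suc k)) (1/-inverse (suc k))
        (∣∣≤-between (proj₁ (proj₂ N,close n N≤n)) (proj₂ (proj₂ N,close n N≤n)))
      where
      N,close = a→l (1/ (suc k)) (0<1/ (suc k))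

  -- If x had an inverse y with |y| <= m, then k = k x y would be at most K m for every k, against
  -- the Archimedean axiom. This is uniqueness of limits, and it turns statements on limits into
  -- equations.
  null-constant⇒≈0 : ∀ {x} → Null (λ _ → x) → x ≈ 0#
  null-constant⇒≈0 {x} (K , small) = ¬#⇒≈ λ x#0 → absurd (#0⇒unit x#0)
    where
    ∣kx∣≤K : ∀ k → ∣ fromℕ k * x ∣≤ K
    ∣kx∣≤K k = proj₂ (small k) (proj₁ (small k)) ℕ.≤-refl
    module _ {y : Carrier} (xy≈1 : x * y ≈ 1#) {m : Carrier} (∣y∣≤m : ∣ y ∣≤ m) (k : ℕ)
        (Km<k : K * m < fromℕ k) where
      kxy≈k : (fromℕ k * x) * y ≈ fromℕ k
      kxy≈k = trans (*-assoc (fromℕ k) x y) (trans (*-congˡ xy≈1) (*-identityʳ (fromℕ k)))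
      ∣k∣≤Km : ∣ fromℕ k ∣≤ (K * m)
      ∣k∣≤Km = ∣∣≤-cong kxy≈k (∣∣≤-* (∣kx∣≤K k) ∣y∣≤m)
      contradictory : 0# < 0#
      contradictory = contradiction (x<y⇒x-y<0 Km<k) (∣_∣≤_.upper ∣k∣≤Km)
    absurd : ¬ (∃[ y ] x * y ≈ 1#)
    absurd (y , xy≈1) = <.irrefl refl
      (contradictory xy≈1 (proj₂ (bounded y)) (proj₁ k,Km<k) (proj₂ k,Km<k))
      where
      k,Km<k = archimedean (K * fromℕ (proj₁ (bounded y)))

  -- Sums and Cauchy products

  ∑< : ℕ → (ℕ → Carrier) → Carrier
  ∑< zero    f = 0#
  ∑< (suc n) f = ∑< n f + f n

  ∑<-cong-< : ∀ n {f g} → (∀ i → i ℕ.< n → f i ≈ g i) → ∑< n f ≈ ∑< n g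
  ∑<-cong-< zero    f≈g = refl
  ∑<-cong-< (suc n) f≈g = +-cong (∑<-cong-< n (λ i i<n → f≈g i (ℕ.m<n⇒m<1+n i<n))) (f≈g n (ℕ.n<1+n n))

  ∑<-cong : ∀ n {f g} → (∀ i → f i ≈ g i) → ∑< n f ≈ ∑< n g
  ∑<-cong n f≈g = ∑<-cong-< n (λ i _ → f≈g i)

  ∑<-+ : ∀ n f g → ∑< n (λ i → f i + g i) ≈ ∑< n f + ∑< n g
  ∑<-+ zero    f g = sym (+-identityˡ 0#)
  ∑<-+ (suc n) f g = trans (+-congʳ (∑<-+ n f g)) (+-interchange (∑< n f) (∑< n g) (f n) (g n))

  ∑<-*ˡ : ∀ n x f → ∑< n (λ i → x * f i) ≈ x * ∑< n f
  ∑<-*ˡ zero    x f = sym (zeroʳ x)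
  ∑<-*ˡ (suc n) x f = trans (+-congʳ (∑<-*ˡ n x f)) (sym (distribˡ x (∑< n f) (f n)))

  ∑<-shift : ∀ n f → ∑< (suc n) f ≈ f 0 + ∑< n (f ∘ suc)
  ∑<-shift zero    f = +-comm 0# (f 0)
  ∑<-shift (suc n) f = trans (+-congʳ (∑<-shift n f)) (+-assoc (f 0) (∑< n (f ∘ suc)) (f (suc n)))

  -- The sum over the antidiagonal i + j = n; for a product of two sequences it is the n-th term of
  -- their Cauchy product.
  diagonal : (ℕ → ℕ → Carrier) → ℕ → Carrier
  diagonal φ zero    = φ 0 0
  diagonal φ (suc n) = φ 0 (suc n) + diagonal (φ ∘ suc) n

  diagonal-cong : ∀ n {φ ψ} → (∀ i j → i ℕ.+ j ≡ n → φ i j ≈ ψ i j) → diagonal φ n ≈ diagonal ψ n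
  diagonal-cong zero    φ≈ψ = φ≈ψ 0 0 ≡.refl
  diagonal-cong (suc n) φ≈ψ =
    +-cong (φ≈ψ 0 (suc n) ≡.refl) (diagonal-cong n (λ i j i+j≡n → φ≈ψ (suc i) j (cong suc i+j≡n)))

  diagonal-+ : ∀ n φ ψ → diagonal (λ i j → φ i j + ψ i j) n ≈ diagonal φ n + diagonal ψ n
  diagonal-+ zero    φ ψ = refl
  diagonal-+ (suc n) φ ψ = trans (+-congˡ (diagonal-+ n (φ ∘ suc) (ψ ∘ suc)))
    (+-interchange (φ 0 (suc n)) (ψ 0 (suc n)) (diagonal (φ ∘ suc) n) (diagonal (ψ ∘ suc) n))

  diagonal-*ˡ : ∀ n x φ → diagonal (λ i j → x * φ i j) n ≈ x * diagonal φ n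
  diagonal-*ˡ zero    x φ = refl
  diagonal-*ˡ (suc n) x φ = trans (+-congˡ (diagonal-*ˡ n x (φ ∘ suc)))
    (sym (distribˡ x (φ 0 (suc n)) (diagonal (φ ∘ suc) n)))

  -- The Leibniz rule for coefficients: the factor n + 1 equals i + j at each entry. The share of i
  -- vanishes at i = 0 and that of j at j = 0, whence the two shifts.
  diagonal-leibniz : ∀ n φ → fromℕ (suc n) * diagonal φ (suc n) ≈
    diagonal (λ i j → fromℕ (suc i) * φ (suc i) j) n + diagonal (λ i j → fromℕ (suc j) * φ i (suc j)) n
  diagonal-leibniz zero φ = trans (distribˡ (fromℕ 1) (φ 0 1) (φ 1 0)) (+-comm _ _)
  diagonal-leibniz (suc n) φ = begin
    fromℕ (2 ℕ.+ n) * (φ 0 (2 ℕ.+ n) + D)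
      ≈⟨ distribˡ _ _ _ ⟩
    a + fromℕ (2 ℕ.+ n) * D
      ≈⟨ +-congˡ (trans (distribʳ _ _ _) (+-cong (*-identityˡ D) (diagonal-leibniz n (φ ∘ suc)))) ⟩
    a + (D + (P + Q))
      ≈⟨ solve 5 (λ a b d p q → a :+ ((b :+ d) :+ (p :+ q)) := (b :+ (d :+ p)) :+ (a :+ q)) refl a
          (φ 1 (suc n)) D′ P Q ⟩
    (φ 1 (suc n) + (D′ + P)) + (a + Q)
      ≈⟨ +-congʳ (+-cong (trans (*-congʳ fromℕ-1) (*-identityˡ _)) D′+P) ⟨
    (fromℕ 1 * φ 1 (suc n) + diagonal (λ i j → fromℕ (2 ℕ.+ i) * φ (2 ℕ.+ i) j) n) + (a + Q)
      ∎
    where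
    a = fromℕ (2 ℕ.+ n) * φ 0 (2 ℕ.+ n)
    D = diagonal (φ ∘ suc) (suc n)
    D′ = diagonal (λ i → φ (2 ℕ.+ i)) n
    P = diagonal (λ i j → fromℕ (suc i) * φ (2 ℕ.+ i) j) n
    Q = diagonal (λ i j → fromℕ (suc j) * φ (suc i) (suc j)) n
    D′+P : diagonal (λ i j → fromℕ (2 ℕ.+ i) * φ (2 ℕ.+ i) j) n ≈ D′ + P
    D′+P = trans (diagonal-cong n (λ i j _ → trans (distribʳ _ _ _) (+-congʳ (*-identityˡ _))))
      (diagonal-+ n _ _)

  ∑<-diagonal-shift : ∀ N (f g : ℕ → Carrier) →
    ∑< (suc N) (diagonal (λ i j → f i * g j)) ≈
    f 0 * ∑< (suc N) g + ∑< N (diagonal (λ i j → f (suc i) * g j))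
  ∑<-diagonal-shift N f g = begin
    ∑< (suc N) (diagonal φ)
      ≈⟨ ∑<-shift N (diagonal φ) ⟩
    f 0 * g 0 + ∑< N (λ n → f 0 * g (suc n) + diagonal (φ ∘ suc) n)
      ≈⟨ +-congˡ (trans (∑<-+ N _ _) (+-congʳ (∑<-*ˡ N (f 0) (g ∘ suc)))) ⟩
    f 0 * g 0 + (f 0 * ∑< N (g ∘ suc) + ∑< N (diagonal (φ ∘ suc)))
      ≈⟨ trans (+-congʳ (distribˡ _ _ _)) (+-assoc _ _ _) ⟨
    f 0 * (g 0 + ∑< N (g ∘ suc)) + ∑< N (diagonal (φ ∘ suc))
      ≈⟨ +-congʳ (*-congˡ (∑<-shift N g)) ⟨
    f 0 * ∑< (suc N) g + ∑< N (diagonal (φ ∘ suc))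
      ∎
    where
    φ : ℕ → ℕ → Carrier
    φ i j = f i * g j

  -- The part of the square 0 ≤ i, j < N above its antidiagonal.
  cauchyDefect : ℕ → (ℕ → Carrier) → (ℕ → Carrier) → Carrier
  cauchyDefect N f g = ∑< N f * ∑< N g - ∑< N (diagonal (λ i j → f i * g j))

  -- Row 0 of the enlarged square lies wholly in the Cauchy product and cancels. The remaining rows
  -- are those of the shifted `f`, and their last column is split off.
  cauchyDefect-suc : ∀ N f g →
    cauchyDefect (suc N) f g ≈ cauchyDefect N (f ∘ suc) g + ∑< N (f ∘ suc) * g N
  cauchyDefect-suc N f g = begin
    ∑< (suc N) f * ∑< (suc N) g - ∑< (suc N) (diagonal (λ i j → f i * g j))
      ≈⟨ +-cong (*-congʳ (∑<-shift N f)) (-‿cong (∑<-diagonal-shift N f g)) ⟩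
    (f 0 + F) * (G + g N) - (f 0 * (G + g N) + D)
      ≈⟨ solve 5 (λ f₀ F G gN D → (f₀ :+ F) :* (G :+ gN) :- (f₀ :* (G :+ gN) :+ D) :=
          (F :* G :- D) :+ F :* gN) refl (f 0) F G (g N) D ⟩
    (F * G - D) + F * g N ∎
    where
    F = ∑< N (f ∘ suc)
    G = ∑< N g
    D = ∑< N (diagonal (λ i j → f (suc i) * g j))

  ∑<-bound : ∀ N {f K} → (∀ i → ∣ f i ∣≤ K) → ∣ ∑< N f ∣≤ (fromℕ N * K)
  ∑<-bound zero    {f} {K} ∣f∣≤K = ∣∣≤-resp refl (sym (zeroˡ K)) (∣0∣≤ 0-nonNegative)
  ∑<-bound (suc N) {f} {K} ∣f∣≤K = ∣∣≤-resp refl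
    (sym (trans (distribʳ K 1# (fromℕ N)) (trans (+-comm _ _) (+-congˡ (*-identityˡ K)))))
    (∣∣≤-+ (∑<-bound N ∣f∣≤K) (∣f∣≤K N))

  -- The base is chosen for the sake of n³≤8^n.
  8^_ : ℕ → Carrier
  8^ n = fromℕ (8 ℕ.^ n)

  8^-+ : ∀ m n → 8^ (m ℕ.+ n) ≈ 8^ m * 8^ n
  8^-+ m n = trans (CR.reflexive (cong fromℕ (ℕ.^-distribˡ-+-* 8 m n))) (fromℕ-* (8 ℕ.^ m) (8 ℕ.^ n))

  8^-drop : ∀ m n {x K} → ∣ 8^ (m ℕ.+ n) * x ∣≤ K → ∣ 8^ m * x ∣≤ K
  8^-drop m n = ∣∣≤-fromℕ-mono (ℕ.^-monoʳ-≤ 8 (ℕ.m≤m+n m n))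

  -- Each entry of the defect has i + j >= N, so with weight 8^(s + N) it is at most F G, and there
  -- are at most N² entries. The offset `s` records the rows already removed by the induction.
  cauchyDefect-bound : ∀ N s f g {F G} →
    (∀ i → ∣ 8^ (s ℕ.+ i) * f i ∣≤ F) → (∀ j → ∣ 8^ j * g j ∣≤ G) →
    ∣ 8^ (s ℕ.+ N) * cauchyDefect N f g ∣≤ (fromℕ (N ℕ.* N) * (F * G))
  cauchyDefect-bound zero s f g {F} {G} ∣f∣≤F ∣g∣≤G =
    ∣∣≤-resp (sym (trans (*-congˡ (trans (+-cong (zeroˡ 0#) -0#≈0#) (+-identityˡ 0#))) (zeroʳ _)))
      (sym (zeroˡ (F * G))) (∣0∣≤ 0-nonNegative)
  cauchyDefect-bound (suc N) s f g {F} {G} ∣f∣≤F ∣g∣≤G =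
    ∣∣≤-weaken (nonNegative-resp (sym slack) (*-nonNegative (fromℕ-nonNegative (suc N)) 0≤FG))
      (∣∣≤-cong (sym split) (∣∣≤-+ (cauchyDefect-bound N (suc s) (f ∘ suc) g ∣f′∣≤F ∣g∣≤G)
          (∣∣≤-* ∣∑f′∣≤NF (∣g∣≤G N))))
    where
    w = 8^ (s ℕ.+ suc N)
    0≤FG : NonNegative (F * G)
    0≤FG = *-nonNegative (bound-nonNegative (∣f∣≤F 0)) (bound-nonNegative (∣g∣≤G 0))
    ∣f′∣≤F : ∀ i → ∣ 8^ (suc s ℕ.+ i) * f (suc i) ∣≤ F
    ∣f′∣≤F i = ≡.subst (λ k → ∣ 8^ k * f (suc i) ∣≤ F) (ℕ.+-suc s i) (∣f∣≤F (suc i))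
    ∣∑f′∣≤NF : ∣ 8^ (suc s) * ∑< N (f ∘ suc) ∣≤ (fromℕ N * F)
    ∣∑f′∣≤NF = ∣∣≤-cong (∑<-*ˡ N (8^ (suc s)) (f ∘ suc)) (∑<-bound N (λ i → 8^-drop (suc s) i (∣f′∣≤F i)))
    w≡ : w ≈ 8^ (suc s ℕ.+ N)
    w≡ = CR.reflexive (cong 8^_ (ℕ.+-suc s N))
    split : w * cauchyDefect (suc N) f g ≈
      8^ (suc s ℕ.+ N) * cauchyDefect N (f ∘ suc) g + (8^ (suc s) * ∑< N (f ∘ suc)) * (8^ N * g N)
    split = begin
      w * cauchyDefect (suc N) f g
        ≈⟨ *-cong w≡ (cauchyDefect-suc N f g) ⟩
      8^ (suc s ℕ.+ N) * (cauchyDefect N (f ∘ suc) g + ∑< N (f ∘ suc) * g N)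
        ≈⟨ distribˡ _ _ _ ⟩
      8^ (suc s ℕ.+ N) * cauchyDefect N (f ∘ suc) g + 8^ (suc s ℕ.+ N) * (∑< N (f ∘ suc) * g N)
        ≈⟨ +-congˡ (trans (*-congʳ (8^-+ (suc s) N)) (interchange _ _ _ _)) ⟩
      8^ (suc s ℕ.+ N) * cauchyDefect N (f ∘ suc) g + (8^ (suc s) * ∑< N (f ∘ suc)) * (8^ N * g N)
        ∎
    suc² : fromℕ (suc N ℕ.* suc N) ≈ (fromℕ (N ℕ.* N) + fromℕ N) + fromℕ (suc N)
    suc² = begin
      fromℕ (suc N ℕ.* suc N)                         ≈⟨ fromℕ-* (suc N) (suc N) ⟩
      (1# + fromℕ N) * (1# + fromℕ N)                 ≈⟨ distribˡ _ _ _ ⟩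
      (1# + fromℕ N) * 1# + (1# + fromℕ N) * fromℕ N
        ≈⟨ +-cong (*-identityʳ _) (trans (distribʳ _ _ _) (+-comm _ _)) ⟩
      (1# + fromℕ N) + (fromℕ N * fromℕ N + 1# * fromℕ N) ≈⟨ +-comm _ _ ⟩
      (fromℕ N * fromℕ N + 1# * fromℕ N) + (1# + fromℕ N)
        ≈⟨ +-congʳ (+-cong (sym (fromℕ-* N N)) (*-identityˡ _)) ⟩
      (fromℕ (N ℕ.* N) + fromℕ N) + fromℕ (suc N)     ∎
    -- (N + 1)² - N² - N = N + 1, so the larger count leaves room for both parts.
    slack : fromℕ (suc N ℕ.* suc N) * (F * G) - (fromℕ (N ℕ.* N) * (F * G) + (fromℕ N * F) * G) ≈
      fromℕ (suc N) * (F * G)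
    slack = trans (+-congʳ (*-congʳ suc²))
      (solve 5 (λ N² N N+1 F G → ((N² :+ N) :+ N+1) :* (F :* G) :- (N² :* (F :* G) :+ (N :* F) :* G) :=
          N+1 :* (F :* G))
        refl (fromℕ (N ℕ.* N)) (fromℕ N) (fromℕ (suc N)) F G)

  -- The cosine series

  -- The divided power: its factorial absorbs the binomial coefficients, so that a power of x + y
  -- expands into a plain antidiagonal sum.
  _⟨_⟩ : Carrier → ℕ → Carrier
  x ⟨ n ⟩ = x ^ n * 1/ (n !) {{n ℕ.!≢0}}

  ^-cong : ∀ n {x y} → x ≈ y → x ^ n ≈ y ^ n
  ^-cong zero    x≈y = refl
  ^-cong (suc n) x≈y = *-cong x≈y (^-cong n x≈y)

  !-*-⟨⟩ : ∀ n x → fromℕ (n !) * x ⟨ n ⟩ ≈ x ^ n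
  !-*-⟨⟩ n x = begin
    fromℕ (n !) * (x ^ n * n!⁻¹)  ≈⟨ x∙yz≈y∙xz (fromℕ (n !)) (x ^ n) n!⁻¹ ⟩
    x ^ n * (fromℕ (n !) * n!⁻¹)  ≈⟨ *-congˡ (1/-inverse (n !) {{n ℕ.!≢0}}) ⟩
    x ^ n * 1#                    ≈⟨ *-identityʳ (x ^ n) ⟩
    x ^ n                         ∎
    where n!⁻¹ = 1/ (n !) {{n ℕ.!≢0}}

  ⟨⟩-zero : ∀ x → x ⟨ 0 ⟩ ≈ 1#
  ⟨⟩-zero x = trans (sym (trans (*-congʳ fromℕ-1) (*-identityˡ (x ⟨ 0 ⟩)))) (!-*-⟨⟩ 0 x)

  ⟨⟩-suc : ∀ n x → fromℕ (suc n) * x ⟨ suc n ⟩ ≈ x * x ⟨ n ⟩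
  ⟨⟩-suc n x = fromℕ-*-cancel (n !) {{n ℕ.!≢0}} (begin
    fromℕ (n !) * (fromℕ (suc n) * x ⟨ suc n ⟩)  ≈⟨ x∙yz≈y∙xz _ _ _ ⟩
    fromℕ (suc n) * (fromℕ (n !) * x ⟨ suc n ⟩)  ≈⟨ *-assoc _ _ _ ⟨
    (fromℕ (suc n) * fromℕ (n !)) * x ⟨ suc n ⟩  ≈⟨ *-congʳ (fromℕ-* (suc n) (n !)) ⟨
    fromℕ (suc n !) * x ⟨ suc n ⟩                ≈⟨ !-*-⟨⟩ (suc n) x ⟩
    x * x ^ n                                    ≈⟨ *-congˡ (!-*-⟨⟩ n x) ⟨
    x * (fromℕ (n !) * x ⟨ n ⟩)                  ≈⟨ x∙yz≈y∙xz _ _ _ ⟩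
    fromℕ (n !) * (x * x ⟨ n ⟩)                  ∎)

  -- The binomial theorem by induction on n, after multiplication by n + 1: the Leibniz rule splits
  -- the sum, and `⟨⟩-suc` turns the two parts into x and y times the sum of degree n.
  ⟨⟩-+ : ∀ n x y → diagonal (λ i j → x ⟨ i ⟩ * y ⟨ j ⟩) n ≈ (x + y) ⟨ n ⟩
  ⟨⟩-+ zero x y = trans (*-cong (⟨⟩-zero x) (⟨⟩-zero y)) (trans (*-identityˡ 1#) (sym (⟨⟩-zero (x + y))))
  ⟨⟩-+ (suc n) x y = fromℕ-*-cancel (suc n) (begin
    fromℕ (suc n) * diagonal (λ i j → x ⟨ i ⟩ * y ⟨ j ⟩) (suc n)
      ≈⟨ diagonal-leibniz n (λ i j → x ⟨ i ⟩ * y ⟨ j ⟩) ⟩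
    diagonal (λ i j → fromℕ (suc i) * (x ⟨ suc i ⟩ * y ⟨ j ⟩)) n +
    diagonal (λ i j → fromℕ (suc j) * (x ⟨ i ⟩ * y ⟨ suc j ⟩)) n
      ≈⟨ +-cong (diagonal-cong n (λ i j _ → ∂x i j)) (diagonal-cong n (λ i j _ → ∂y i j)) ⟩
    diagonal (λ i j → x * (x ⟨ i ⟩ * y ⟨ j ⟩)) n + diagonal (λ i j → y * (x ⟨ i ⟩ * y ⟨ j ⟩)) n
      ≈⟨ +-cong (diagonal-*ˡ n x φ) (diagonal-*ˡ n y φ) ⟩
    x * diagonal φ n + y * diagonal φ n
      ≈⟨ distribʳ (diagonal φ n) x y ⟨
    (x + y) * diagonal φ n
      ≈⟨ *-congˡ (⟨⟩-+ n x y) ⟩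
    (x + y) * (x + y) ⟨ n ⟩
      ≈⟨ ⟨⟩-suc n (x + y) ⟨
    fromℕ (suc n) * (x + y) ⟨ suc n ⟩
      ∎)
    where
    φ : ℕ → ℕ → Carrier
    φ i j = x ⟨ i ⟩ * y ⟨ j ⟩
    ∂x : ∀ i j → fromℕ (suc i) * (x ⟨ suc i ⟩ * y ⟨ j ⟩) ≈ x * φ i j
    ∂x i j = trans (sym (*-assoc _ _ _)) (trans (*-congʳ (⟨⟩-suc i x)) (*-assoc _ _ _))
    ∂y : ∀ i j → fromℕ (suc j) * (x ⟨ i ⟩ * y ⟨ suc j ⟩) ≈ y * φ i j
    ∂y i j = trans (x∙yz≈y∙xz _ _ _) (trans (*-congˡ (⟨⟩-suc j y)) (x∙yz≈y∙xz _ _ _))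

  [-1]^ : ℕ → Carrier
  [-1]^ n = (- 1#) ^ n

  ⟨⟩-neg : ∀ n x → (- x) ⟨ n ⟩ ≈ [-1]^ n * x ⟨ n ⟩
  ⟨⟩-neg n x = trans (*-congʳ (^-neg n)) (*-assoc ([-1]^ n) (x ^ n) _)
    where
    ^-neg : ∀ n → (- x) ^ n ≈ [-1]^ n * x ^ n
    ^-neg zero    = sym (*-identityˡ 1#)
    ^-neg (suc n) = trans (*-cong (sym (-1*x≈-x x)) (^-neg n)) (interchange (- 1#) x ([-1]^ n) (x ^ n))

  -- The coefficients of the cosine series with respect to the divided powers.
  χ : ℕ → Carrier
  χ zero          = 1#
  χ (suc zero)    = 0#
  χ (suc (suc n)) = - χ n

  [-1]^-+2 : ∀ n → [-1]^ (2 ℕ.+ n) ≈ [-1]^ n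
  [-1]^-+2 n = trans (-1*x≈-x _) (trans (-‿cong (-1*x≈-x ([-1]^ n))) (-‿involutive ([-1]^ n)))

  -- As χ n is cos (n π / 2), this is d'Alembert's equation for χ, with χ (m - j) written as (-1)^j
  -- χ (m + j).
  χ-product : ∀ m j → χ (m ℕ.+ j) * (1# + [-1]^ j) ≈ fromℕ 2 * (χ m * χ j)
  χ-product m zero = begin
    χ (m ℕ.+ 0) * (1# + 1#)       ≡⟨ cong (λ k → χ k * (1# + 1#)) (ℕ.+-identityʳ m) ⟩
    χ m * (1# + 1#)               ≈⟨ *-comm _ _ ⟩
    (1# + 1#) * χ m               ≈⟨ *-cong (+-congˡ (sym fromℕ-1)) (sym (*-identityʳ (χ m))) ⟩
    fromℕ 2 * (χ m * 1#)          ∎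
  χ-product m (suc zero) = begin
    χ (m ℕ.+ 1) * (1# + - 1# * 1#)  ≈⟨ *-congˡ (trans (+-congˡ (*-identityʳ (- 1#))) (-‿inverseʳ 1#)) ⟩
    χ (m ℕ.+ 1) * 0#                ≈⟨ zeroʳ _ ⟩
    0#                              ≈⟨ trans (*-congˡ (zeroʳ (χ m))) (zeroʳ _) ⟨
    fromℕ 2 * (χ m * 0#)            ∎
  χ-product m (suc (suc j)) = begin
    χ (m ℕ.+ (2 ℕ.+ j)) * (1# + [-1]^ (2 ℕ.+ j))
      ≈⟨ *-cong (CR.reflexive (cong χ m+[2+j])) (+-congˡ ([-1]^-+2 j)) ⟩
    - χ (m ℕ.+ j) * (1# + [-1]^ j)
      ≈⟨ -‿distribˡ-* _ _ ⟨
    - (χ (m ℕ.+ j) * (1# + [-1]^ j))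
      ≈⟨ -‿cong (χ-product m j) ⟩
    - (fromℕ 2 * (χ m * χ j))
      ≈⟨ trans (-‿distribʳ-* _ _) (*-congˡ (-‿distribʳ-* _ _)) ⟩
    fromℕ 2 * (χ m * - χ j)
      ∎
    where
    m+[2+j] : m ℕ.+ (2 ℕ.+ j) ≡ 2 ℕ.+ (m ℕ.+ j)
    m+[2+j] = ≡.trans (ℕ.+-suc m (suc j)) (cong suc (ℕ.+-suc m j))

  cosTerm : Carrier → ℕ → Carrier
  cosTerm x n = χ n * x ⟨ n ⟩

  -- The terms of odd degree in y cancel between x + y and x - y. In the others `χ-product`
  -- distributes the sign over the two factors.
  cosTerm-dAlembert : ∀ n x y → cosTerm (x + y) n + cosTerm (x - y) n ≈
    fromℕ 2 * diagonal (λ i j → cosTerm x i * cosTerm y j) n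
  cosTerm-dAlembert n x y = begin
    χ n * (x + y) ⟨ n ⟩ + χ n * (x - y) ⟨ n ⟩
      ≈⟨ distribˡ _ _ _ ⟨
    χ n * ((x + y) ⟨ n ⟩ + (x - y) ⟨ n ⟩)
      ≈⟨ *-congˡ (+-cong (⟨⟩-+ n x y) (⟨⟩-+ n x (- y))) ⟨
    χ n * (diagonal (λ i j → x ⟨ i ⟩ * y ⟨ j ⟩) n + diagonal (λ i j → x ⟨ i ⟩ * (- y) ⟨ j ⟩) n)
      ≈⟨ *-congˡ (diagonal-+ n _ _) ⟨
    χ n * diagonal (λ i j → x ⟨ i ⟩ * y ⟨ j ⟩ + x ⟨ i ⟩ * (- y) ⟨ j ⟩) n
      ≈⟨ diagonal-*ˡ n (χ n) _ ⟨
    diagonal (λ i j → χ n * (x ⟨ i ⟩ * y ⟨ j ⟩ + x ⟨ i ⟩ * (- y) ⟨ j ⟩)) n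
      ≈⟨ diagonal-cong n entry ⟩
    diagonal (λ i j → fromℕ 2 * (cosTerm x i * cosTerm y j)) n
      ≈⟨ diagonal-*ˡ n (fromℕ 2) _ ⟩
    fromℕ 2 * diagonal (λ i j → cosTerm x i * cosTerm y j) n
      ∎
    where
    entry : ∀ i j → i ℕ.+ j ≡ n →
      χ n * (x ⟨ i ⟩ * y ⟨ j ⟩ + x ⟨ i ⟩ * (- y) ⟨ j ⟩) ≈ fromℕ 2 * (cosTerm x i * cosTerm y j)
    entry i j ≡.refl = begin
      χ (i ℕ.+ j) * (x ⟨ i ⟩ * y ⟨ j ⟩ + x ⟨ i ⟩ * (- y) ⟨ j ⟩)
        ≈⟨ *-congˡ (+-cong (sym (*-identityˡ _)) (trans (*-congˡ (⟨⟩-neg j y)) (x∙yz≈y∙xz _ _ _))) ⟩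
      χ (i ℕ.+ j) * (1# * (x ⟨ i ⟩ * y ⟨ j ⟩) + [-1]^ j * (x ⟨ i ⟩ * y ⟨ j ⟩))
        ≈⟨ *-congˡ (distribʳ _ _ _) ⟨
      χ (i ℕ.+ j) * ((1# + [-1]^ j) * (x ⟨ i ⟩ * y ⟨ j ⟩))
        ≈⟨ trans (sym (*-assoc _ _ _)) (*-congʳ (χ-product i j)) ⟩
      (fromℕ 2 * (χ i * χ j)) * (x ⟨ i ⟩ * y ⟨ j ⟩)
        ≈⟨ trans (*-assoc _ _ _) (*-congˡ (interchange _ _ _ _)) ⟩
      fromℕ 2 * (cosTerm x i * cosTerm y j)
        ∎

  χ-even : ∀ n → χ (2 ℕ.* n) ≈ [-1]^ n
  χ-even zero    = refl
  χ-even (suc n) = trans (CR.reflexive (cong χ (ℕ.*-suc 2 n))) (trans (-‿cong (χ-even n)) (sym (-1*x≈-x _)))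

  χ-odd : ∀ n → χ (suc (2 ℕ.* n)) ≈ 0#
  χ-odd zero    = refl
  χ-odd (suc n) = trans (CR.reflexive (cong (λ m → χ (suc m)) (ℕ.*-suc 2 n))) (trans (-‿cong (χ-odd n)) -0#≈0#)

  -- Inserting the vanishing odd terms indexes the series by degree, as the Cauchy product requires;
  -- the number of terms doubles.
  cosPartialSum≈ : ∀ x N → cosPartialSum R x N ≈ ∑< (2 ℕ.* N) (cosTerm x)
  cosPartialSum≈ x zero    = refl
  cosPartialSum≈ x (suc N) = begin
    cosPartialSum R x N + ([-1]^ N * x ^ (2 ℕ.* N)) * 1/ ((2 ℕ.* N) !) {{(2 ℕ.* N) ℕ.!≢0}}
      ≈⟨ +-cong (cosPartialSum≈ x N) (*-assoc _ _ _) ⟩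
    ∑< (2 ℕ.* N) (cosTerm x) + [-1]^ N * x ⟨ 2 ℕ.* N ⟩
      ≈⟨ +-congˡ (*-congʳ (χ-even N)) ⟨
    ∑< (2 ℕ.* N) (cosTerm x) + cosTerm x (2 ℕ.* N)
      ≈⟨ trans (+-congˡ (trans (*-congʳ (χ-odd N)) (zeroˡ _))) (+-identityʳ _) ⟨
    (∑< (2 ℕ.* N) (cosTerm x) + cosTerm x (2 ℕ.* N)) + cosTerm x (suc (2 ℕ.* N))
      ≡⟨ cong (λ m → ∑< m (cosTerm x)) (ℕ.*-suc 2 N) ⟨
    ∑< (2 ℕ.* suc N) (cosTerm x)
      ∎

  cosPartialSum-cong : ∀ N {x y} → x ≈ y → cosPartialSum R x N ≈ cosPartialSum R y N
  cosPartialSum-cong zero    x≈y = refl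
  cosPartialSum-cong (suc N) x≈y =
    +-cong (cosPartialSum-cong N x≈y) (*-congʳ (*-congˡ (^-cong (2 ℕ.* N) x≈y)))

  χ-bound : ∀ n → ∣ χ n ∣≤ 1#
  χ-bound zero          = ∣1∣≤1
  χ-bound (suc zero)    = ∣0∣≤ (positive⇒nonNegative 0<1)
  χ-bound (suc (suc n)) = ∣∣≤-neg (χ-bound n)

  8^-*-^-bound : ∀ {x A} → ∣ fromℕ 8 * x ∣≤ fromℕ A → ∀ n → ∣ 8^ n * x ^ n ∣≤ fromℕ (A ℕ.^ n)
  8^-*-^-bound ∣8x∣≤A zero    = ∣∣≤-resp (trans (sym (*-identityʳ 1#)) (*-congʳ (sym fromℕ-1)))
      (sym fromℕ-1) ∣1∣≤1
  8^-*-^-bound {x} {A} ∣8x∣≤A (suc n) = ∣∣≤-resp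
    (trans (interchange (fromℕ 8) x (8^ n) (x ^ n)) (*-congʳ (sym (fromℕ-* 8 (8 ℕ.^ n)))))
    (sym (fromℕ-* A (A ℕ.^ n)))
    (∣∣≤-* ∣8x∣≤A (8^-*-^-bound ∣8x∣≤A n))

  -- 8^n |x|^n <= A^n <= A^A n!, and the factorial cancels.
  ⟨⟩-bound : ∀ {x} A .{{_ : NonZero A}} → ∣ fromℕ 8 * x ∣≤ fromℕ A → ∀ n → ∣ 8^ n * x ⟨ n ⟩ ∣≤ fromℕ (A ℕ.^ A)
  ⟨⟩-bound {x} A ∣8x∣≤A n = ∣∣≤-cancel (0<fromℕ (n !) {{n ℕ.!≢0}}) (∣∣≤-resp
    (trans (*-congˡ (sym (!-*-⟨⟩ n x))) (x∙yz≈y∙xz (8^ n) (fromℕ (n !)) (x ⟨ n ⟩)))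
    (trans (fromℕ-* (A ℕ.^ A) (n !)) (*-comm _ _))
    (∣∣≤-weaken (fromℕ-mono-≤ (a^n≤a^a*n! A n)) (8^-*-^-bound ∣8x∣≤A n)))

  cosTerm-bound : ∀ x → ∃[ K ] ∀ n → ∣ 8^ n * cosTerm x n ∣≤ K
  cosTerm-bound x = 1# * fromℕ (A ℕ.^ A) , λ n →
    ∣∣≤-*-swap (χ-bound n) (⟨⟩-bound A ∣8x∣≤A n)
    where
    m = proj₁ (bounded (fromℕ 8 * x))
    -- The successor makes A nonzero, as `⟨⟩-bound` demands.
    A = suc m
    ∣8x∣≤A : ∣ fromℕ 8 * x ∣≤ fromℕ A
    ∣8x∣≤A = ∣∣≤-weaken (fromℕ-mono-≤ (ℕ.n≤1+n m)) (proj₂ (bounded (fromℕ 8 * x)))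

  -- k N² <= N³ <= 8^N, while 8^N times the defect is at most N² F G; the factor N² cancels.
  cauchyDefect-small : ∀ k N f g {F G} → k ℕ.< N →
    (∀ i → ∣ 8^ i * f i ∣≤ F) → (∀ j → ∣ 8^ j * g j ∣≤ G) →
    ∣ fromℕ k * cauchyDefect N f g ∣≤ (F * G)
  cauchyDefect-small k N@(suc _) f g k<N ∣f∣≤F ∣g∣≤G = ∣∣≤-cancel (0<fromℕ (N ℕ.* N))
    (∣∣≤-cong (trans (*-congʳ (trans (fromℕ-* k (N ℕ.* N)) (*-comm _ _))) (*-assoc _ _ _))
      (∣∣≤-fromℕ-mono (ℕ.≤-trans (ℕ.*-monoˡ-≤ (N ℕ.* N) (ℕ.<⇒≤ k<N)) (n³≤8^n N))
        (cauchyDefect-bound N 0 f g ∣f∣≤F ∣g∣≤G)))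

  cauchyDefect-null : ∀ x y → Null (λ N → cauchyDefect (2 ℕ.* N) (cosTerm x) (cosTerm y))
  cauchyDefect-null x y = proj₁ (cosTerm-bound x) * proj₁ (cosTerm-bound y) , λ k → suc k , λ N k<N →
    cauchyDefect-small k (2 ℕ.* N) (cosTerm x) (cosTerm y) (ℕ.<-≤-trans k<N (ℕ.m≤m+n N (N ℕ.+ 0)))
      (proj₂ (cosTerm-bound x)) (proj₂ (cosTerm-bound y))

  -- Exact at every finite stage: the Cauchy defect is all that separates the partial sums from the
  -- functional equation.
  cosPartialSum-dAlembert : ∀ N x y → cosPartialSum R (x + y) N + cosPartialSum R (x - y) N ≈
    fromℕ 2 * (cosPartialSum R x N * cosPartialSum R y N - cauchyDefect (2 ℕ.* N) (cosTerm x) (cosTerm y))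
  cosPartialSum-dAlembert N x y = begin
    cosPartialSum R (x + y) N + cosPartialSum R (x - y) N
      ≈⟨ +-cong (cosPartialSum≈ (x + y) N) (cosPartialSum≈ (x - y) N) ⟩
    ∑< (2 ℕ.* N) (cosTerm (x + y)) + ∑< (2 ℕ.* N) (cosTerm (x - y))
      ≈⟨ ∑<-+ (2 ℕ.* N) _ _ ⟨
    ∑< (2 ℕ.* N) (λ n → cosTerm (x + y) n + cosTerm (x - y) n)
      ≈⟨ ∑<-cong (2 ℕ.* N) (λ n → cosTerm-dAlembert n x y) ⟩
    ∑< (2 ℕ.* N) (λ n → fromℕ 2 * diagonal (λ i j → cosTerm x i * cosTerm y j) n)
      ≈⟨ ∑<-*ˡ (2 ℕ.* N) (fromℕ 2) _ ⟩
    fromℕ 2 * D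
      ≈⟨ *-congˡ (x-[x-y]≈y (X * Y) D) ⟨
    fromℕ 2 * (X * Y - (X * Y - D))
      ≈⟨ *-congˡ (+-congʳ (*-cong (cosPartialSum≈ x N) (cosPartialSum≈ y N))) ⟨
    fromℕ 2 * (cosPartialSum R x N * cosPartialSum R y N - (X * Y - D))
      ∎
    where
    X = ∑< (2 ℕ.* N) (cosTerm x)
    Y = ∑< (2 ℕ.* N) (cosTerm y)
    D = ∑< (2 ℕ.* N) (diagonal (λ i j → cosTerm x i * cosTerm y j))
    x-[x-y]≈y : ∀ x y → x - (x - y) ≈ y
    x-[x-y]≈y = solve 2 (λ x y → x :- (x :- y) := y) refl

  -- The functional equation of the cosine

  module Cosine {cos : Carrier → Carrier} (isCosine : IsCosine R cos) where

    private
      error : Carrier → ℕ → Carrier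
      error x N = cosPartialSum R x N - cos x

      error-null : ∀ x → Null (error x)
      error-null x = convergesTo⇒null (isCosine x)

    -- The cosine is given as a bare function on a setoid; that it respects `≈` follows because the
    -- partial sums do and limits are unique.
    cos-cong : ∀ {x y} → x ≈ y → cos x ≈ cos y
    cos-cong {x} {y} x≈y = x-y≈0⇒x≈y (null-constant⇒≈0
      (null-cong difference (null-+ (error-null y) (null-neg (error-null x)))))
      where
      difference : ∀ N → error y N - error x N ≈ cos x - cos y
      difference N = trans (+-congˡ (-‿cong (+-congʳ (cosPartialSum-cong N x≈y))))
        (solve 3 (λ p a b → (p :- b) :- (p :- a) := a :- b) refl (cosPartialSum R y N) (cos x) (cos y))

    cos-0 : cos 0# ≈ 1#
    cos-0 = sym (x-y≈0⇒x≈y (null-constant⇒≈0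
      -- The empty partial sum is 0 and all others are 1, so the first one is dropped.
      (null-cong (λ N → +-congʳ (partialSum-0 N)) (null-tail (error-null 0#)))))
      where
      partialSum-0 : ∀ N → cosPartialSum R 0# (suc N) ≈ 1#
      partialSum-0 zero    = trans (+-identityˡ _) (trans (*-assoc _ _ _) (trans (*-identityˡ _) (⟨⟩-zero 0#)))
      partialSum-0 (suc N) = trans
        (+-cong (partialSum-0 N) (trans (*-congʳ (trans (*-congˡ (zeroˡ _)) (zeroʳ _))) (zeroˡ _)))
        (+-identityʳ 1#)

    -- With X, Y tending to a, b, the expansion X Y - a b = (X - a) (Y - b) + a (Y - b) + b (X - a)
    -- displays the constant difference of the two sides as a combination of null sequences.
    cos-dAlembert : ∀ x y → cos (x + y) + cos (x - y) ≈ fromℕ 2 * (cos x * cos y)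
    cos-dAlembert x y = x-y≈0⇒x≈y (null-constant⇒≈0 (null-cong total
      (null-+ (null-neg (null-+ (error-null (x + y)) (error-null (x - y))))
        (null-scale (fromℕ 2) (null-+
          (null-+ (null-+ (null-* (error-null x) (error-null y)) (null-scale (cos x) (error-null y)))
            (null-scale (cos y) (error-null x)))
          (null-neg (cauchyDefect-null x y)))))))
      where
      E : ℕ → Carrier
      E N = cauchyDefect (2 ℕ.* N) (cosTerm x) (cosTerm y)
      -- Stated for arbitrary values, since the hypothesis has to be substituted between two calls
      -- of the solver.
      cancel : ∀ P Q X Y E p q a b → P + Q ≈ fromℕ 2 * (X * Y - E) →
        - ((P - p) + (Q - q)) + fromℕ 2 * ((((X - a) * (Y - b) + a * (Y - b)) + b * (X - a)) - E) ≈
        (p + q) - fromℕ 2 * (a * b)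
      cancel P Q X Y E p q a b P+Q≈ = begin
        - ((P - p) + (Q - q)) + fromℕ 2 * ((((X - a) * (Y - b) + a * (Y - b)) + b * (X - a)) - E)
          ≈⟨ +-congʳ (-‿cong (solve 4 (λ P Q p q → (P :- p) :+ (Q :- q) := (P :+ Q) :- (p :+ q)) refl P Q
              p q)) ⟩
        - ((P + Q) - (p + q)) + fromℕ 2 * ((((X - a) * (Y - b) + a * (Y - b)) + b * (X - a)) - E)
          ≈⟨ +-congʳ (-‿cong (+-congʳ P+Q≈)) ⟩
        - (fromℕ 2 * (X * Y - E) - (p + q)) + fromℕ 2 * ((((X - a) * (Y - b) + a * (Y - b)) + b * (X - a)) - E)
          ≈⟨ solve 6 (λ X Y E s a b →
               :- (con (+ 2) :* (X :* Y :- E) :- s) :+ con (+ 2) :*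
                   ((((X :- a) :* (Y :- b) :+ a :* (Y :- b)) :+ b :* (X :- a)) :- E)
               := s :- con (+ 2) :* (a :* b)) refl X Y E (p + q) a b ⟩
        (p + q) - fromℕ 2 * (a * b)
          ∎
      total : ∀ N →
        - (error (x + y) N + error (x - y) N) +
          fromℕ 2 * (((error x N * error y N + cos x * error y N) + cos y * error x N) - E N) ≈
        (cos (x + y) + cos (x - y)) - fromℕ 2 * (cos x * cos y)
      total N = cancel _ _ _ _ _ _ _ _ _ (cosPartialSum-dAlembert N x y)

  -- D'Alembert's functional equation

  ∑<-rotate : ∀ n f → f n ≈ f 0 → ∑< n (f ∘ suc) ≈ ∑< n f
  ∑<-rotate n f fn≈f0 = begin
    ∑< n (f ∘ suc)                  ≈⟨ solve 2 (λ x s → s := (x :+ s) :- x) refl (f 0) (∑< n (f ∘ suc)) ⟩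
    (f 0 + ∑< n (f ∘ suc)) - f 0    ≈⟨ +-congʳ (∑<-shift n f) ⟨
    (∑< n f + f n) - f 0            ≈⟨ +-congʳ (+-congˡ fn≈f0) ⟩
    (∑< n f + f 0) - f 0            ≈⟨ solve 2 (λ x s → (s :+ x) :- x := s) refl (f 0) (∑< n f) ⟩
    ∑< n f                          ∎

  module DAlembert
    {f : Carrier → Carrier} (f-cong : ∀ {x y} → x ≈ y → f x ≈ f y) (f-0 : f 0# ≈ 1#)
    (dAlembert : ∀ x y → f (x + y) + f (x - y) ≈ fromℕ 2 * (f x * f y))
    where

    f-even : ∀ x → f (- x) ≈ f x
    f-even x = begin
      f (- x)                       ≈⟨ solve 2 (λ a b → b := (a :+ b) :- a) refl (f x) (f (- x)) ⟩
      (f x + f (- x)) - f x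
        ≈⟨ +-congʳ (+-cong (f-cong (+-identityˡ x)) (f-cong (+-identityˡ (- x)))) ⟨
      (f (0# + x) + f (0# - x)) - f x
        ≈⟨ +-congʳ (trans (dAlembert 0# x) (*-congˡ (trans (*-congʳ f-0) (*-identityˡ (f x))))) ⟩
      fromℕ 2 * f x - f x           ≈⟨ solve 1 (λ a → con (+ 2) :* a :- a := a) refl (f x) ⟩
      f x                           ∎

    Period : Carrier → Set _
    Period a = ∀ x → f (x + a) ≈ f x

    period-cong : ∀ {a b} → a ≈ b → Period a → Period b
    period-cong a≈b period x = trans (f-cong (+-congˡ (sym a≈b))) (period x)

    period-+ : ∀ {a b} → Period a → Period b → Period (a + b)
    period-+ {a} {b} periodᵃ periodᵇ x = trans (f-cong (sym (+-assoc x a b)))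
        (trans (periodᵇ (x + a)) (periodᵃ x))

    period-neg : ∀ {a} → Period a → Period (- a)
    period-neg {a} period x = trans (sym (period (x - a)))
      (f-cong (solve 2 (λ x a → (x :- a) :+ a := x) refl x a))

    period-*ˡ : ∀ k {a} → Period a → Period (fromℕ k * a)
    period-*ˡ zero    {a} period x = f-cong (trans (+-congˡ (zeroˡ a)) (+-identityʳ x))
    period-*ˡ (suc k) {a} period = period-cong
      (trans (+-congʳ (sym (*-identityˡ a))) (sym (distribʳ a 1# (fromℕ k))))
      (period-+ period (period-*ˡ k period))

    period-fromℤ : ∀ i {a} → Period a → Period (fromℤ i * a)
    period-fromℤ (+ n)    period = period-*ˡ n period
    period-fromℤ -[1+ n ] period = period-cong (-‿distribˡ-* _ _) (period-neg (period-*ˡ (suc n) period))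

    period-∣∣ : ∀ i {a} → Period (fromℤ i * a) → Period (fromℕ ℤ.∣ i ∣ * a)
    period-∣∣ (+ n)    period = period
    period-∣∣ -[1+ n ] period = period-cong (trans (-‿distribˡ-* _ _) (*-congʳ (-‿involutive _)))
        (period-neg period)

    module _ {θ : Carrier} (fθ≈1 : f θ ≈ 1#) where

      f-step : ∀ x → f (x + θ) + f (x - θ) ≈ fromℕ 2 * f x
      f-step x = trans (dAlembert x θ) (*-congˡ (trans (*-congˡ fθ≈1) (*-identityʳ (f x))))

      -- When f θ = 1, d'Alembert's equation says that second differences with step θ vanish.
      f-arithmetic : ∀ x k → f (x + fromℕ k * θ) ≈ f x + fromℕ k * (f (x + θ) - f x)
      f-arithmetic x zero = begin
        f (x + 0# * θ)                  ≈⟨ f-cong (trans (+-congˡ (zeroˡ θ)) (+-identityʳ x)) ⟩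
        f x                             ≈⟨ trans (+-congˡ (zeroˡ _)) (+-identityʳ (f x)) ⟨
        f x + 0# * (f (x + θ) - f x)    ∎
      f-arithmetic x (suc zero) = begin
        f (x + fromℕ 1 * θ)                 ≈⟨ f-cong (+-congˡ (trans (*-congʳ fromℕ-1) (*-identityˡ θ))) ⟩
        f (x + θ)
          ≈⟨ solve 2 (λ a b → a := b :+ con 1ℤ :* (a :- b)) refl (f (x + θ)) (f x) ⟩
        f x + fromℕ 1 * (f (x + θ) - f x)   ∎
      f-arithmetic x (suc (suc k)) = begin
        f (x + (1# + (1# + K)) * θ)
          ≈⟨ f-cong next ⟩
        f (y + θ)
          ≈⟨ solve 2 (λ a b → a := (a :+ b) :- b) refl (f (y + θ)) (f (y - θ)) ⟩
        (f (y + θ) + f (y - θ)) - f (y - θ)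
          ≈⟨ +-cong (f-step y) (-‿cong (f-cong previous)) ⟩
        fromℕ 2 * f y - f (x + K * θ)
          ≈⟨ +-cong (*-congˡ (f-arithmetic x (suc k))) (-‿cong (f-arithmetic x k)) ⟩
        fromℕ 2 * (f x + (1# + K) * D) - (f x + K * D)
          ≈⟨ +-congʳ (*-congˡ (+-congˡ (trans (distribʳ D 1# K) (+-congʳ (*-identityˡ D))))) ⟩
        fromℕ 2 * (f x + (D + K * D)) - (f x + K * D)
          ≈⟨ solve 3 (λ a d e → con (+ 2) :* (a :+ (d :+ e)) :- (a :+ e) := a :+ (d :+ (d :+ e))) refl
              (f x) D (K * D) ⟩
        f x + (D + (D + K * D))
          ≈⟨ +-congˡ (trans (distribʳ D 1# (1# + K))
              (+-cong (*-identityˡ D) (trans (distribʳ D 1# K) (+-congʳ (*-identityˡ D))))) ⟨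
        f x + (1# + (1# + K)) * D
          ∎
        where
        K = fromℕ k
        D = f (x + θ) - f x
        y = x + (1# + K) * θ
        next : x + (1# + (1# + K)) * θ ≈ y + θ
        next = trans (+-congˡ (trans (distribʳ θ 1# (1# + K))
            (trans (+-congʳ (*-identityˡ θ)) (+-comm _ _)))) (sym (+-assoc x _ θ))
        previous : y - θ ≈ x + K * θ
        previous = trans (+-congʳ (+-congˡ (trans (distribʳ θ 1# K) (+-congʳ (*-identityˡ θ)))))
          (solve 3 (λ x t s → (x :+ (t :+ s)) :- t := x :+ s) refl x θ (K * θ))

      -- An arithmetic progression that is periodic is constant.
      f≈1⇒period : ∀ N .{{_ : NonZero N}} → Period (fromℕ N * θ) → Period θ
      f≈1⇒period N period x = x-y≈0⇒x≈y (#0-*-cancel (fromℕ#0 N) (begin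
        fromℕ N * (f (x + θ) - f x)
          ≈⟨ solve 2 (λ a b → b := (a :+ b) :- a) refl (f x) (fromℕ N * (f (x + θ) - f x)) ⟩
        (f x + fromℕ N * (f (x + θ) - f x)) - f x
          ≈⟨ +-congʳ (f-arithmetic x N) ⟨
        f (x + fromℕ N * θ) - f x
          ≈⟨ x≈y⇒x-y≈0 (period x) ⟩
        0#
          ∎))

    -- Periods form a group, and Bézout writes a as an integer combination of m a and n a.
    period-coprime : ∀ {m n a} → Coprime m n → Period (fromℕ m * a) → Period (fromℕ n * a) → Period a
    period-coprime {m} {n} {a} m⊥n periodᵐ periodⁿ = combine (coprime-Bézout m⊥n)
      where
      difference : ∀ x y m n → 1 ℕ.+ y ℕ.* n ≡ x ℕ.* m → fromℕ x * (fromℕ m * a) - fromℕ y * (fromℕ n * a) ≈ a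
      difference x y m n eq = begin
        fromℕ x * (fromℕ m * a) - fromℕ y * (fromℕ n * a)
          ≈⟨ +-cong (assoc x m) (-‿cong (assoc y n)) ⟩
        fromℕ (x ℕ.* m) * a - fromℕ (y ℕ.* n) * a
          ≡⟨ cong (λ k → fromℕ k * a - fromℕ (y ℕ.* n) * a) eq ⟨
        (1# + fromℕ (y ℕ.* n)) * a - fromℕ (y ℕ.* n) * a
          ≈⟨ +-congʳ (trans (distribʳ a 1# _) (+-congʳ (*-identityˡ a))) ⟩
        (a + fromℕ (y ℕ.* n) * a) - fromℕ (y ℕ.* n) * a
          ≈⟨ solve 2 (λ a b → (a :+ b) :- b := a) refl a (fromℕ (y ℕ.* n) * a) ⟩
        a
          ∎
        where
        assoc : ∀ x m → fromℕ x * (fromℕ m * a) ≈ fromℕ (x ℕ.* m) * a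
        assoc x m = trans (sym (*-assoc _ _ a)) (*-congʳ (sym (fromℕ-* x m)))
      combine : Bézout.Identity 1 m n → Period a
      combine (Bézout.+- x y eq) = period-cong (difference x y m n eq)
        (period-+ (period-*ˡ x periodᵐ) (period-neg (period-*ˡ y periodⁿ)))
      combine (Bézout.-+ x y eq) = period-cong (difference y x n m eq)
        (period-+ (period-*ˡ y periodⁿ) (period-neg (period-*ˡ x periodᵐ)))

    -- Multiplying the sum by 2 f θ shifts its argument both ways, hence doubles it.
    ∑<-equidistant : ∀ N {θ} → Period (fromℕ N * θ) → ¬ (f θ ≈ 1#) → ∑< N (λ k → f (fromℕ k * θ)) ≈ 0#
    ∑<-equidistant N {θ} period fθ≉1 = ¬#⇒≈ λ S#0 →
      fθ≉1 (x-y≈0⇒x≈y (#0-*-cancel S#0 S*[fθ-1]≈0))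
      where
      g G : ℕ → Carrier
      g k = f (fromℕ k * θ)
      G k = f (fromℕ k * θ - θ)
      S = ∑< N g
      [1+k]θ : ∀ k → fromℕ (suc k) * θ ≈ fromℕ k * θ + θ
      [1+k]θ k = trans (distribʳ θ 1# (fromℕ k)) (trans (+-comm _ _) (+-congˡ (*-identityˡ θ)))
      up : ∑< N (λ k → f (fromℕ k * θ + θ)) ≈ S
      up = trans (∑<-cong N (λ k → f-cong (sym ([1+k]θ k)))) (∑<-rotate N g
        (trans (f-cong (sym (+-identityˡ _))) (trans (period 0#) (f-cong (sym (zeroˡ θ))))))
      down : ∑< N G ≈ S
      down = trans (sym (∑<-rotate N G (f-cong-period))) (∑<-cong N (λ k → f-cong
        (trans (+-congʳ ([1+k]θ k)) (solve 2 (λ a t → (a :+ t) :- t := a) refl (fromℕ k * θ) θ))))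
        where
        f-cong-period : G N ≈ G 0
        f-cong-period = trans (f-cong (+-comm _ _)) (trans (period (- θ))
          (f-cong (sym (trans (+-congʳ (zeroˡ θ)) (+-identityˡ _)))))
      doubled : fromℕ 2 * (f θ * S) ≈ S + S
      doubled = begin
        fromℕ 2 * (f θ * S)
          ≈⟨ trans (∑<-*ˡ N _ _) (*-congˡ (∑<-*ˡ N _ _)) ⟨
        ∑< N (λ k → fromℕ 2 * (f θ * g k))
          ≈⟨ ∑<-cong N (λ k → trans (*-congˡ (*-comm (f θ) (g k))) (sym (dAlembert (fromℕ k * θ) θ))) ⟩
        ∑< N (λ k → f (fromℕ k * θ + θ) + G k)
          ≈⟨ ∑<-+ N _ G ⟩
        ∑< N (λ k → f (fromℕ k * θ + θ)) + ∑< N G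
          ≈⟨ +-cong up down ⟩
        S + S
          ∎
      S*[fθ-1]≈0 : S * (f θ - 1#) ≈ 0#
      S*[fθ-1]≈0 = #0-*-cancel (fromℕ#0 2) (begin
        -- The constant 1 of the solver evaluates to `fromℕ 1`, which is `1# + 0#`.
        fromℕ 2 * (S * (f θ - 1#))                      ≈⟨ *-congˡ (*-congˡ (+-congˡ (-‿cong fromℕ-1))) ⟨
        fromℕ 2 * (S * (f θ - fromℕ 1))
          ≈⟨ solve 2 (λ s t → con (+ 2) :* (s :* (t :- con 1ℤ)) := con (+ 2) :* (t :* s) :- (s :+ s)) refl
              S (f θ) ⟩
        fromℕ 2 * (f θ * S) - (S + S)                   ≈⟨ x≈y⇒x-y≈0 doubled ⟩
        0#                                              ∎)

    module QuarterPeriod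
      {h : Carrier} (0<h : 0# < h) (fh≈0 : f h ≈ 0#) (h-least : ∀ x → 0# < x → x < h → ¬ (f x ≈ 0#))
      where

      -- D'Alembert's equation at x + h with step h: its right-hand side vanishes with f h.
      f-half : ∀ x → f (x + (h + h)) ≈ - f x
      f-half x = begin
        f (x + (h + h))
          ≈⟨ solve 2 (λ a b → a := (a :+ b) :- b) refl (f (x + (h + h))) (f x) ⟩
        (f (x + (h + h)) + f x) - f x
          ≈⟨ +-congʳ (+-cong (f-cong (sym (+-assoc x h h)))
              (f-cong (solve 2 (λ x h → x := (x :+ h) :- h) refl x h))) ⟩
        (f ((x + h) + h) + f ((x + h) - h)) - f x
          ≈⟨ +-congʳ (trans (dAlembert (x + h) h)
              (trans (*-congˡ (trans (*-congˡ fh≈0) (zeroʳ _))) (zeroʳ _))) ⟩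
        0# - f x
          ≈⟨ +-identityˡ _ ⟩
        - f x
          ∎

      period-4h : Period (fromℕ 4 * h)
      period-4h = period-cong (solve 1 (λ h → (h :+ h) :+ (h :+ h) := con (+ 4) :* h) refl h)
        (λ x → trans (f-cong (sym (+-assoc x _ _)))
            (trans (f-half _) (trans (-‿cong (f-half x)) (-‿involutive (f x)))))

      -- Here z is the fraction M / N of h, strictly between 0 and h.
      no-zero : ∀ N M .{{_ : NonZero M}} {z} → M ℕ.< N → fromℕ N * z ≈ fromℕ M * h → ¬ (f z ≈ 0#)
      no-zero N@(suc _) M {z} M<N Nz≈Mh = h-least z 0<z z<h
        where
        0<z : 0# < z
        0<z = positive-cancel (0<fromℕ N) (<-resp-≈ refl (sym Nz≈Mh) (*-positive (0<fromℕ M) 0<h))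
        N[h-z] : (fromℕ N - fromℕ M) * h ≈ fromℕ N * (h - z)
        N[h-z] = begin
          (fromℕ N - fromℕ M) * h
            ≈⟨ solve 3 (λ n m h → (n :- m) :* h := n :* h :- m :* h) refl (fromℕ N) (fromℕ M) h ⟩
          fromℕ N * h - fromℕ M * h        ≈⟨ +-congˡ (-‿cong Nz≈Mh) ⟨
          fromℕ N * h - fromℕ N * z
            ≈⟨ solve 3 (λ n h z → n :* h :- n :* z := n :* (h :- z)) refl (fromℕ N) h z ⟩
          fromℕ N * (h - z)                ∎
        z<h : z < h
        z<h = 0<y-x⇒x<y (positive-cancel (0<fromℕ N) (<-resp-≈ refl N[h-z]
          (*-positive (x<y⇒0<y-x (fromℕ-mono-< M<N)) 0<h)))

      -- Except for N = 2 and N = 4, the zero ∣h - ω∣ of f lies strictly between 0 and h.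
      no-period : ∀ N {ω} → 2 ℕ.≤ N → fromℕ N * ω ≈ fromℕ 4 * h → ¬ Period ω
      -- Here ω = 2 h, a shift that changes the sign of f, so that 1 = f 0 would equal -1.
      no-period 2 {ω} _ 2ω≈4h period = ≈⇒¬# 2≈0 (fromℕ#0 2)
        where
        ω≈2h : ω ≈ h + h
        ω≈2h = fromℕ-*-cancel 2 (trans 2ω≈4h (solve 1 (λ h → con (+ 4) :* h := con (+ 2) :* (h :+ h)) refl h))
        1≈-1 : 1# ≈ - 1#
        1≈-1 = begin
          1#               ≈⟨ f-0 ⟨
          f 0#             ≈⟨ period 0# ⟨
          f (0# + ω)       ≈⟨ f-cong (+-congˡ ω≈2h) ⟩
          f (0# + (h + h)) ≈⟨ f-half 0# ⟩
          - f 0#           ≈⟨ -‿cong f-0 ⟩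
          - 1#             ∎
        2≈0 : fromℕ 2 ≈ 0#
        2≈0 = trans (+-cong 1≈-1 fromℕ-1) (-‿inverseˡ 1#)
      no-period 3 {ω} _ 3ω≈4h period = no-zero 3 1 (ℕ.s≤s (ℕ.s≤s ℕ.z≤n)) 3z≈h fz≈0
        where
        3z≈h : fromℕ 3 * (ω - h) ≈ fromℕ 1 * h
        3z≈h = begin
          fromℕ 3 * (ω - h)
            ≈⟨ solve 2 (λ w h → con (+ 3) :* (w :- h) := con (+ 3) :* w :- con (+ 3) :* h) refl ω h ⟩
          fromℕ 3 * ω - fromℕ 3 * h   ≈⟨ +-congʳ 3ω≈4h ⟩
          fromℕ 4 * h - fromℕ 3 * h
            ≈⟨ solve 1 (λ h → con (+ 4) :* h :- con (+ 3) :* h := con (+ 1) :* h) refl h ⟩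
          fromℕ 1 * h                 ∎
        fz≈0 : f (ω - h) ≈ 0#
        fz≈0 = trans (f-cong (+-comm ω (- h))) (trans (period (- h)) (trans (f-even h) fh≈0))
      -- Here ω = h, so that 1 = f 0 would equal f h = 0.
      no-period 4 {ω} _ 4ω≈4h period = ≈⇒¬# 1≈0 (0<⇒#0 0<1)
        where
        1≈0 : 1# ≈ 0#
        1≈0 = begin
          1#          ≈⟨ f-0 ⟨
          f 0#        ≈⟨ period 0# ⟨
          f (0# + ω)  ≈⟨ f-cong (trans (+-identityˡ ω) (fromℕ-*-cancel 4 4ω≈4h)) ⟩
          f h         ≈⟨ fh≈0 ⟩
          0#          ∎
      no-period N@(suc (suc (suc (suc (suc j))))) {ω} _ Nω≈4h period =
        no-zero N (suc j) (ℕ.s≤s (ℕ.m≤n+m (suc j) 3)) Nz≈ (trans (period-neg period h) fh≈0)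
        where
        Nz≈ : fromℕ N * (h - ω) ≈ fromℕ (suc j) * h
        Nz≈ = begin
          fromℕ N * (h - ω)
            ≈⟨ solve 3 (λ n h w → n :* (h :- w) := n :* h :- n :* w) refl (fromℕ N) h ω ⟩
          fromℕ N * h - fromℕ N * ω
            ≈⟨ +-cong (*-congʳ (fromℕ-+ 4 (suc j))) (-‿cong Nω≈4h) ⟩
          (fromℕ 4 + fromℕ (suc j)) * h - fromℕ 4 * h
            ≈⟨ solve 3 (λ m n h → (m :+ n) :* h :- m :* h := n :* h) refl (fromℕ 4) (fromℕ (suc j)) h ⟩
          fromℕ (suc j) * h                             ∎
      no-period 0 ()
      no-period 1 (ℕ.s≤s ())

      ∑<-orthogonal : ∀ N m {ω} → 2 ℕ.≤ N → fromℕ N * ω ≈ fromℕ 4 * h → Coprime ℤ.∣ m ∣ N →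
        ∑< N (λ k → f (fromℕ k * (fromℤ m * ω))) ≈ 0#
      ∑<-orthogonal N@(suc _) m {ω} 2≤N Nω≈4h m⊥N = ∑<-equidistant N period-Nθ λ fθ≈1 →
        no-period N 2≤N Nω≈4h (period-coprime m⊥N (period-∣∣ m (f≈1⇒period fθ≈1 N period-Nθ)) period-Nω)
        where
        period-Nω : Period (fromℕ N * ω)
        period-Nω = period-cong (sym Nω≈4h) period-4h
        period-Nθ : Period (fromℕ N * (fromℤ m * ω))
        period-Nθ = period-cong (x∙yz≈y∙xz (fromℤ m) (fromℕ N) ω) (period-fromℤ m period-Nω)

  -- Laurent polynomials as translation operators

  product-cong : ∀ {t} {x y : Vector Carrier t} → (∀ j → x j ≈ y j) → product x ≈ product y
  product-cong {zero}  x≈y = refl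
  product-cong {suc t} x≈y = *-cong (x≈y zero) (product-cong (λ j → x≈y (suc j)))

  fromℕ-^ : ∀ m n → fromℕ m ^ n ≈ fromℕ (m ℕ.^ n)
  fromℕ-^ m zero    = sym fromℕ-1
  fromℕ-^ m (suc n) = trans (*-congˡ (fromℕ-^ m n)) (sym (fromℕ-* m (m ℕ.^ n)))

  product-2^ : ∀ {t} (h : Vector ℕ t) → product (λ j → fromℕ 2 ^ h j) ≈ fromℕ (2 ℕ.^ ℕΣ.sum h)
  product-2^ {zero}  h = sym fromℕ-1
  product-2^ {suc t} h = begin
    fromℕ 2 ^ h zero * product (λ j → fromℕ 2 ^ h (suc j))
      ≈⟨ *-cong (fromℕ-^ 2 (h zero)) (product-2^ (λ j → h (suc j))) ⟩
    fromℕ (2 ℕ.^ h zero) * fromℕ (2 ℕ.^ ℕΣ.sum (λ j → h (suc j)))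
      ≈⟨ fromℕ-* (2 ℕ.^ h zero) (2 ℕ.^ ℕΣ.sum (λ j → h (suc j))) ⟨
    fromℕ (2 ℕ.^ h zero ℕ.* 2 ℕ.^ ℕΣ.sum (λ j → h (suc j)))
      ≡⟨ cong fromℕ (ℕ.^-distribˡ-+-* 2 (h zero) (ℕΣ.sum (λ j → h (suc j)))) ⟨
    fromℕ (2 ℕ.^ ℕΣ.sum h)
      ∎

  module LaurentAction
    {f : Carrier → Carrier} (f-cong : ∀ {x y} → x ≈ y → f x ≈ f y) (f-0 : f 0# ≈ 1#)
    (dAlembert : ∀ x y → f (x + y) + f (x - y) ≈ fromℕ 2 * (f x * f y))
    where

    -- The effect at x of the operator obtained from a Laurent polynomial by reading u as the translation by y.
    apply : Laurent → Carrier → Carrier → Carrier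
    apply []            y x = 0#
    apply ((e , a) ∷ L) y x = fromℤ a * f (x + fromℤ e * y) + apply L y x

    apply-++ : ∀ L M y x → apply (L ++ M) y x ≈ apply L y x + apply M y x
    apply-++ []            M y x = sym (+-identityˡ _)
    apply-++ ((e , a) ∷ L) M y x = trans (+-congˡ (apply-++ L M y x)) (sym (+-assoc _ _ _))

    apply-map : ∀ e a M y x →
      apply (map (λ (e′ , b) → e ℤ.+ e′ , a ℤ.* b) M) y x ≈ fromℤ a * apply M y (x + fromℤ e * y)
    apply-map e a []             y x = sym (zeroʳ (fromℤ a))
    apply-map e a ((e′ , b) ∷ M) y x = trans
      (+-cong (trans (*-cong (fromℤ-* a b) (f-cong exponents)) (*-assoc _ _ _)) (apply-map e a M y x))
      (sym (distribˡ (fromℤ a) _ _))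
      where
      exponents : x + fromℤ (e ℤ.+ e′) * y ≈ (x + fromℤ e * y) + fromℤ e′ * y
      exponents = trans (+-congˡ (trans (*-congʳ (fromℤ-+ e e′)) (distribʳ y (fromℤ e) (fromℤ e′))))
          (sym (+-assoc _ _ _))

    -- Required at every x, because in a product of operators the second one is evaluated at
    -- translated points.
    record HasEigenvalue (L : Laurent) (y d : Carrier) : Set (c ⊔ ℓ₁) where
      constructor eigenvalue
      field
        apply≈ : ∀ x → apply L y x ≈ d * f x

    open HasEigenvalue

    eigenvalue-1 : ∀ y → HasEigenvalue L.1# y 1#
    eigenvalue-1 y = eigenvalue λ x → trans (+-identityʳ _)
      (*-cong fromℕ-1 (f-cong (trans (+-congˡ (zeroˡ y)) (+-identityʳ x))))

    eigenvalue-* : ∀ {L M y b d} → HasEigenvalue L y b → HasEigenvalue M y d → HasEigenvalue (L L.* M) y (b * d)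
    eigenvalue-* {L} {M} {y} {b} {d} L-b M-d = eigenvalue λ x →
      trans (apply-* x L) (trans (*-congˡ (apply≈ L-b x))
          (trans (x∙yz≈y∙xz d b (f x)) (sym (*-assoc b d (f x)))))
      where
      apply-* : ∀ x L → apply (L L.* M) y x ≈ d * apply L y x
      apply-* x []            = sym (zeroʳ d)
      apply-* x ((e , a) ∷ L) = begin
        apply (((e , a) ∷ L) L.* M) y x
          ≈⟨ apply-++ (map _ M) (L L.* M) y x ⟩
        apply (map _ M) y x + apply (L L.* M) y x
          ≈⟨ +-cong (trans (apply-map e a M y x) (*-congˡ (apply≈ M-d (x + fromℤ e * y)))) (apply-* x L) ⟩
        fromℤ a * (d * f (x + fromℤ e * y)) + d * apply L y x
          ≈⟨ trans (+-congʳ (x∙yz≈y∙xz _ d _)) (sym (distribˡ d _ _)) ⟩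
        d * apply ((e , a) ∷ L) y x
          ∎

    eigenvalue-^ : ∀ {L y d} n → HasEigenvalue L y d → HasEigenvalue (L LΠ.^ n) y (d ^ n)
    eigenvalue-^ zero    L-d = eigenvalue-1 _
    eigenvalue-^ (suc n) L-d = eigenvalue-* L-d (eigenvalue-^ n L-d)

    eigenvalue-product : ∀ {t} {L : Vector Laurent t} {y} {d : Vector Carrier t} →
      (∀ j → HasEigenvalue (L j) y (d j)) → HasEigenvalue (LΠ.product L) y (product d)
    eigenvalue-product {zero}  L-d = eigenvalue-1 _
    eigenvalue-product {suc t} L-d = eigenvalue-* (L-d zero) (eigenvalue-product (λ j → L-d (suc j)))

    -- This is d'Alembert's equation with step r y.
    eigenvalue-generator : ∀ r y → HasEigenvalue (generator r) y (fromℕ 2 * f (fromℤ r * y))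
    eigenvalue-generator r y = eigenvalue λ x → begin
      fromℕ 1 * f (x + fromℤ r * y) + (fromℕ 1 * f (x + fromℤ (ℤ.- r) * y) + 0#)
        ≈⟨ +-cong (trans (*-congʳ fromℕ-1) (*-identityˡ _))
            (trans (+-identityʳ _) (trans (*-congʳ fromℕ-1) (*-identityˡ _))) ⟩
      f (x + fromℤ r * y) + f (x + fromℤ (ℤ.- r) * y)
        ≈⟨ +-congˡ (f-cong (+-congˡ (trans (*-congʳ (fromℤ-neg r)) (sym (-‿distribˡ-* (fromℤ r) y))))) ⟩
      f (x + fromℤ r * y) + f (x - fromℤ r * y)
        ≈⟨ dAlembert x (fromℤ r * y) ⟩
      fromℕ 2 * (f x * f (fromℤ r * y))
        ≈⟨ trans (*-congˡ (*-comm _ _)) (sym (*-assoc _ _ _)) ⟩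
      (fromℕ 2 * f (fromℤ r * y)) * f x
        ∎

    module _ (P : Pattern) where
      open Pattern P

      factor : Carrier → Vector Carrier t
      factor y j = (fromℕ 2 * f (fromℤ (r j) * y)) ^ h j

      monomial : Carrier → Carrier
      monomial y = product (factor y)

      monomial-cong : ∀ {x y} → x ≈ y → monomial x ≈ monomial y
      monomial-cong {x} {y} x≈y = product-cong {x = factor x} {factor y}
        (λ j → ^-cong (h j) (*-congˡ (f-cong (*-congˡ x≈y))))

      monomial-0 : monomial 0# ≈ fromℕ (2 ℕ.^ H)
      monomial-0 = trans
        (product-cong {x = factor 0#} {λ j → fromℕ 2 ^ h j}
          (λ j → ^-cong (h j) (trans (*-congˡ (trans (f-cong (zeroʳ (fromℤ (r j)))) f-0))
              (*-identityʳ (fromℕ 2)))))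
        (product-2^ h)

      apply-generatingPolynomial : ∀ y → apply (generatingPolynomial P) y 0# ≈ monomial y
      apply-generatingPolynomial y = trans
        (apply≈ (eigenvalue-product {L = generatingFactor P} {d = factor y}
            (λ j → eigenvalue-^ (h j) (eigenvalue-generator (r j) y))) 0#)
        (trans (*-congˡ f-0) (*-identityʳ (monomial y)))

    module _ (N : ℕ) (ω : Carrier)
      (orthogonal : ∀ e → Coprime ℤ.∣ e ∣ N → ∑< N (λ k → f (fromℕ k * (fromℤ e * ω))) ≈ 0#)
      where

      ∑<-apply : ∀ {b} → (∀ e → e ≢ 0ℤ → ℤ.∣ e ∣ ℕ.≤ b → Coprime ℤ.∣ e ∣ N) → ∀ L → HasDegree≤ b L →
        ∑< N (λ k → apply L (fromℕ k * ω) 0#) ≈ fromℕ N * fromℤ (coefficient 0ℤ L)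
      ∑<-apply coprime [] [] = trans (trans (∑<-cong N (λ _ → sym (zeroˡ 0#))) (∑<-*ˡ N 0# _))
        (trans (zeroˡ _) (sym (zeroʳ _)))
      ∑<-apply coprime ((e , a) ∷ L) (e≤b ∷ L≤b) = begin
        ∑< N (λ k → fromℤ a * f (0# + fromℤ e * (fromℕ k * ω)) + apply L (fromℕ k * ω) 0#)
          ≈⟨ ∑<-+ N _ _ ⟩
        ∑< N (λ k → fromℤ a * f (0# + fromℤ e * (fromℕ k * ω))) + ∑< N (λ k → apply L (fromℕ k * ω) 0#)
          ≈⟨ +-cong (trans (∑<-*ˡ N (fromℤ a) _)
              (*-congˡ (∑<-cong N (λ k → f-cong (trans (+-identityˡ _) (x∙yz≈y∙xz _ _ _))))))
               (∑<-apply coprime L L≤b) ⟩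
        fromℤ a * ∑< N (λ k → f (fromℕ k * (fromℤ e * ω))) + fromℕ N * fromℤ (coefficient 0ℤ L)
          ≈⟨ add-term (e ℤ.≟ 0ℤ) ⟩
        fromℕ N * fromℤ (coefficient 0ℤ ((e , a) ∷ L))
          ∎
        where
        add-term : Dec (e ≡ 0ℤ) →
          fromℤ a * ∑< N (λ k → f (fromℕ k * (fromℤ e * ω))) + fromℕ N * fromℤ (coefficient 0ℤ L) ≈
          fromℕ N * fromℤ (coefficient 0ℤ ((e , a) ∷ L))
        add-term (no e≢0) = trans
          (+-congʳ (trans (*-congˡ (orthogonal e (coprime e e≢0 e≤b))) (zeroʳ _)))
          (trans (+-identityˡ _) (*-congˡ (CR.reflexive (cong fromℤ (≡.sym (coefficient-≢ a L e≢0))))))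
        -- At exponent 0 each of the N samples is f 0 = 1, so the term contributes N a.
        add-term (yes ≡.refl) = begin
          fromℤ a * ∑< N (λ k → f (fromℕ k * (0# * ω))) + fromℕ N * fromℤ (coefficient 0ℤ L)
            ≈⟨ +-congʳ (*-congˡ (trans (∑<-cong N
                (λ k → trans (f-cong (trans (*-congˡ (zeroˡ ω)) (zeroʳ (fromℕ k)))) f-0)) (∑<-1 N))) ⟩
          fromℤ a * fromℕ N + fromℕ N * fromℤ (coefficient 0ℤ L)
            ≈⟨ trans (+-congʳ (*-comm _ _)) (sym (distribˡ _ _ _)) ⟩
          fromℕ N * (fromℤ a + fromℤ (coefficient 0ℤ L))
            ≈⟨ *-congˡ (trans (CR.reflexive (cong fromℤ (coefficient-≡ 0ℤ a L)))
                (fromℤ-+ a (coefficient 0ℤ L))) ⟨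
          fromℕ N * fromℤ (coefficient 0ℤ ((0ℤ , a) ∷ L))
            ∎
          where
          ∑<-1 : ∀ n → ∑< n (λ _ → 1#) ≈ fromℕ n
          ∑<-1 zero    = refl
          ∑<-1 (suc n) = trans (+-congʳ (∑<-1 n)) (+-comm _ _)

      ∑<-monomial : ∀ P → (∀ e → e ≢ 0ℤ → ℤ.∣ e ∣ ℕ.≤ Pattern.B P → Coprime ℤ.∣ e ∣ N) →
        ∑< N (λ k → monomial P (fromℕ k * ω)) ≈ fromℕ N * fromℤ (S₀ P)
      ∑<-monomial P coprime = trans (∑<-cong N (λ k → sym (apply-generatingPolynomial P (fromℕ k * ω))))
        (∑<-apply coprime (generatingPolynomial P) (hasDegree≤-generatingPolynomial P))

  -- Sums over residues with a given gcd

  -- Branches on `does`, as `filter` does, so that both reduce in the same case split.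
  only : ∀ {P : Set} → Dec P → Carrier → Carrier
  only P? x = if does P? then x else 0#

  only-yes : ∀ {P : Set} (P? : Dec P) {x} → P → only P? x ≈ x
  only-yes (yes _) _ = refl
  only-yes (no ¬p) p = contradiction p ¬p

  only-no : ∀ {P : Set} (P? : Dec P) {x} → ¬ P → only P? x ≈ 0#
  only-no (yes p) ¬p = contradiction p ¬p
  only-no (no _)  _  = refl

  ∑-filter : ∀ {A : Set} {P : A → Set} (P? : Decidable P) g ks →
    ∑ R (filter P? ks) g ≈ ∑ R ks (λ k → only (P? k) (g k))
  ∑-filter P? g []       = refl
  ∑-filter P? g (k ∷ ks) with does (P? k)
  ... | true  = +-congˡ (∑-filter P? g ks)
  ... | false = trans (∑-filter P? g ks) (sym (+-identityˡ _))

  ∑-tabulate : ∀ {A : Set} m {ι : Fin m → A} {g F} → (∀ i → g (ι i) ≈ F (toℕ i)) → ∑ R (tabulate ι) g ≈ ∑< m F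
  ∑-tabulate zero    g≈F = refl
  ∑-tabulate (suc m) {F = F} g≈F = trans (+-cong (g≈F zero) (∑-tabulate m (λ i → g≈F (suc i))))
      (sym (∑<-shift m F))

  ∑<-pred : ∀ n .{{_ : NonZero n}} F → ∑< n F ≈ F 0 + ∑< (ℕ.pred n) (F ∘ suc)
  ∑<-pred (suc n) F = ∑<-shift n F

  ∑<-0 : ∀ n {F} → (∀ i → i ℕ.< n → F i ≈ 0#) → ∑< n F ≈ 0#
  ∑<-0 zero    F≈0 = refl
  ∑<-0 (suc n) F≈0 = trans (+-cong (∑<-0 n (λ i i<n → F≈0 i (ℕ.m<n⇒m<1+n i<n))) (F≈0 n (ℕ.n<1+n n)))
      (+-identityʳ 0#)

  ∑<-split : ∀ m n F → ∑< (m ℕ.+ n) F ≈ ∑< m F + ∑< n (λ j → F (m ℕ.+ j))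
  ∑<-split m zero    F = trans (CR.reflexive (cong (λ k → ∑< k F) (ℕ.+-identityʳ m))) (sym (+-identityʳ _))
  ∑<-split m (suc n) F = trans (CR.reflexive (cong (λ k → ∑< k F) (ℕ.+-suc m n)))
    (trans (+-congʳ (∑<-split m n F)) (+-assoc _ _ _))

  ∑<-blocks : ∀ a b F → ∑< (a ℕ.* b) F ≈ ∑< a (λ l → ∑< b (λ j → F (l ℕ.* b ℕ.+ j)))
  ∑<-blocks zero    b F = refl
  ∑<-blocks (suc a) b F = trans (CR.reflexive (cong (λ k → ∑< k F) (ℕ.+-comm b (a ℕ.* b))))
    (trans (∑<-split (a ℕ.* b) b F) (+-congʳ (∑<-blocks a b F)))

  -- In blocks of length b only the first entry is a multiple of b, and for 0 < l < a the gcd of l b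
  -- and a b is exactly b because a is prime. The summand `G 0` completes the progression. The
  -- equation for `n` lets the same n = p q be read with its factors in either order.
  ∑<-gcd : ∀ {n a b} (G : ℕ → Carrier) → Prime a → Prime b → n ≡ a ℕ.* b →
    G 0 + ∑< (ℕ.pred n) (λ i → only (gcd (suc i) n ℕ.≟ b) (G (suc i))) ≈ ∑< a (λ l → G (l ℕ.* b))
  ∑<-gcd {n} {a} {b} G a-prime b-prime ≡.refl = begin
    G 0 + ∑< (ℕ.pred n) (W ∘ suc)
      -- The index 0 joins the sum at no cost: its gcd with n is n, which exceeds b.
      ≈⟨ +-congˡ (trans (sym (+-identityˡ _)) (trans (+-congʳ (sym W0≈0)) (sym (∑<-pred n W)))) ⟩
    G 0 + ∑< n W
      ≈⟨ +-congˡ (trans (∑<-blocks a b W) (∑<-cong a block)) ⟩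
    G 0 + ∑< a (λ l → W (l ℕ.* b))
      ≈⟨ +-congˡ (trans (∑<-pred a (λ l → W (l ℕ.* b))) (trans (+-congʳ W0≈0) (+-identityˡ _))) ⟩
    G 0 + ∑< (ℕ.pred a) (λ l → W (suc l ℕ.* b))
      ≈⟨ +-congˡ (∑<-cong-< (ℕ.pred a) (λ l l<a-1 → only-yes (gcd (suc l ℕ.* b) n ℕ.≟ b)
           (gcd[l*b,a*b]≡b b {suc l} a-prime (ℕ.<-≤-trans (ℕ.s<s l<a-1) (ℕ.≤-reflexive (ℕ.suc-pred a)))))) ⟩
    G 0 + ∑< (ℕ.pred a) (λ l → G (suc l ℕ.* b))
      ≈⟨ ∑<-pred a (λ l → G (l ℕ.* b)) ⟨
    ∑< a (λ l → G (l ℕ.* b))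
      ∎
    where
    instance
      a≢0 = prime⇒nonZero a-prime
      b≢0 = prime⇒nonZero b-prime
      n≢0 = ℕ.m*n≢0 a b
    W : ℕ → Carrier
    W k = only (gcd k n ℕ.≟ b) (G k)
    b<n : b ℕ.< a ℕ.* b
    b<n = ℕ.<-≤-trans (ℕ.m<m+n b (ℕ.>-nonZero⁻¹ b))
        (ℕ.≤-trans (ℕ.≤-reflexive (cong (b ℕ.+_) (≡.sym (ℕ.+-identityʳ b)))) (ℕ.*-monoˡ-≤ b (2≤prime a-prime)))
    W0≈0 : W 0 ≈ 0#
    W0≈0 = only-no (gcd 0 n ℕ.≟ b) (λ gcd≡b → ℕ.<-irrefl (≡.trans (≡.sym gcd≡b) (gcd-identityˡ n)) b<n)
    block : ∀ l → ∑< b (λ j → W (l ℕ.* b ℕ.+ j)) ≈ W (l ℕ.* b)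
    block l = trans (∑<-pred b (λ j → W (l ℕ.* b ℕ.+ j))) (trans
      (+-cong (CR.reflexive (cong W (ℕ.+-identityʳ (l ℕ.* b))))
        (∑<-0 (ℕ.pred b) (λ j j<b-1 → only-no (gcd (l ℕ.* b ℕ.+ suc j) n ℕ.≟ b)
          (gcd[l*b+j,n]≢b b l (suc j) n (ℕ.<-≤-trans (ℕ.s<s j<b-1) (ℕ.≤-reflexive (ℕ.suc-pred b)))))))
      (+-identityʳ _))

  -- Below p q the gcd is 1, p or q, and as p and q differ, exactly one of the three summands
  -- survives.
  ∑<-gcd-partition : ∀ {p q} (G : ℕ → Carrier) → Prime p → Prime q → p ≢ q → let n = p ℕ.* q in
    ∑< (ℕ.pred n) (λ i → only (gcd (suc i) n ℕ.≟ 1) (G (suc i))) +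
    (∑< (ℕ.pred n) (λ i → only (gcd (suc i) n ℕ.≟ p) (G (suc i))) +
     ∑< (ℕ.pred n) (λ i → only (gcd (suc i) n ℕ.≟ q) (G (suc i)))) ≈
    ∑< (ℕ.pred n) (G ∘ suc)
  ∑<-gcd-partition {p} {q} G p-prime q-prime p≢q = trans
    (sym (trans (∑<-+ m _ _) (+-congˡ (∑<-+ m _ _))))
    (∑<-cong-< m (λ i i<m → partition i
      (gcd[k,p*q] (suc i) p-prime q-prime (ℕ.<-≤-trans (ℕ.s<s i<m) (ℕ.≤-reflexive (ℕ.suc-pred n))))))
    where
    n = p ℕ.* q
    m = ℕ.pred n
    instance
      p≢0 = prime⇒nonZero p-prime
      q≢0 = prime⇒nonZero q-prime
      n≢0 = ℕ.m*n≢0 p q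
    prime≢1 : ∀ {p} → Prime p → p ≢ 1
    prime≢1 p-prime p≡1 = ℕ.<-irrefl (≡.sym p≡1) (2≤prime p-prime)
    W : ℕ → ℕ → Carrier
    W d i = only (gcd (suc i) n ℕ.≟ d) (G (suc i))
    hit : ∀ {d i} → gcd (suc i) n ≡ d → W d i ≈ G (suc i)
    hit {d} {i} = only-yes (gcd (suc i) n ℕ.≟ d)
    miss : ∀ {d e i} → d ≢ e → gcd (suc i) n ≡ d → W e i ≈ 0#
    miss {d} {e} {i} d≢e gcd≡d = only-no (gcd (suc i) n ℕ.≟ e) (λ gcd≡e → d≢e (≡.trans (≡.sym gcd≡d) gcd≡e))
    partition : ∀ i → (gcd (suc i) n ≡ 1 ⊎ gcd (suc i) n ≡ p) ⊎ gcd (suc i) n ≡ q →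
      W 1 i + (W p i + W q i) ≈ G (suc i)
    partition i (inj₁ (inj₁ ≡1)) = trans
      (+-cong (hit ≡1) (trans (+-cong (miss (prime≢1 p-prime ∘ ≡.sym) ≡1)
          (miss (prime≢1 q-prime ∘ ≡.sym) ≡1)) (+-identityʳ 0#)))
      (+-identityʳ _)
    partition i (inj₁ (inj₂ ≡p)) = trans
      (+-cong (miss (prime≢1 p-prime) ≡p) (trans (+-cong (hit ≡p) (miss p≢q ≡p)) (+-identityʳ _)))
      (+-identityˡ _)
    partition i (inj₂ ≡q) = trans
      (+-cong (miss (prime≢1 q-prime) ≡q) (trans (+-cong (miss (p≢q ∘ ≡.sym) ≡q) (hit ≡q)) (+-identityˡ _)))
      (+-identityˡ _)

  -- The sums at the cosine values

  module Evaluation {cos : Carrier → Carrier} (isCosine : IsCosine R cos) {π : Carrier}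
      (isPi : IsPi R cos π) where

    open Cosine isCosine
    open DAlembert cos-cong cos-0 cos-dAlembert
    open QuarterPeriod (*-positive (IsPi.0<π isPi) (0<1/ 2)) (IsPi.cos[π/2] isPi) (IsPi.π/2-least isPi)
    open LaurentAction cos-cong cos-0 cos-dAlembert

    private
      h = π * 1/ 2

      step : (n : ℕ) .{{_ : NonZero n}} → Carrier
      step n = (fromℕ 2 * π) * 1/ n

    n*step≈4h : ∀ n .{{_ : NonZero n}} → fromℕ n * step n ≈ fromℕ 4 * h
    n*step≈4h n = begin
      fromℕ n * ((fromℕ 2 * π) * 1/ n)        ≈⟨ x∙yz≈y∙xz _ _ _ ⟩
      (fromℕ 2 * π) * (fromℕ n * 1/ n)        ≈⟨ *-congˡ (trans (1/-inverse n) (sym (1/-inverse 2))) ⟩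
      (fromℕ 2 * π) * (fromℕ 2 * 1/ 2)
        ≈⟨ solve 2 (λ x i → (con (+ 2) :* x) :* (con (+ 2) :* i) := con (+ 4) :* (x :* i)) refl π (1/ 2) ⟩
      fromℕ 4 * (π * 1/ 2)                    ∎

    -- Only N ω = 2π is asked of ω, so that it may also be one prime times the step of p q.
    ∑<-cosines : ∀ P N ω → 2 ℕ.≤ N → fromℕ N * ω ≈ fromℕ 4 * h →
      (∀ e → e ≢ 0ℤ → ℤ.∣ e ∣ ℕ.≤ Pattern.B P → Coprime ℤ.∣ e ∣ N) →
      ∑< N (λ k → monomial P (fromℕ k * ω)) ≈ fromℕ N * fromℤ (S₀ P)
    ∑<-cosines P N ω 2≤N Nω≈4h = ∑<-monomial N ω (λ e → ∑<-orthogonal N e 2≤N Nω≈4h) P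

    module _ (n : ℕ) .{{_ : NonZero n}} where

      -- Reduction modulo n changes the argument by a multiple of n steps, a full period.
      cos-residue : ∀ r (k : Ω n) → cos (fromℕ (residue n r k) * step n) ≈
        cos (fromℤ r * (fromℕ ⟦ k ⟧ * step n))
      cos-residue r k = begin
        cos (fromℕ m * ω)
          ≈⟨ period-fromℤ q (period-cong (sym (n*step≈4h n)) period-4h) (fromℕ m * ω) ⟨
        cos (fromℕ m * ω + fromℤ q * (fromℕ n * ω))
          ≈⟨ cos-cong (trans (+-congˡ (sym (*-assoc _ _ _))) (sym (distribʳ ω _ _))) ⟩
        cos ((fromℕ m + fromℤ q * fromℕ n) * ω)
          ≈⟨ cos-cong (*-congʳ division) ⟩
        cos (fromℤ (r ℤ.* + ⟦ k ⟧) * ω)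
          ≈⟨ cos-cong (trans (*-congʳ (fromℤ-* r (+ ⟦ k ⟧))) (*-assoc _ _ _)) ⟩
        cos (fromℤ r * (fromℕ ⟦ k ⟧ * ω))
          ∎
        where
        ω = step n
        m = residue n r k
        q = _/ℕ_ (r ℤ.* + ⟦ k ⟧) n {{nonZero n k}}
        division : fromℕ m + fromℤ q * fromℕ n ≈ fromℤ (r ℤ.* + ⟦ k ⟧)
        division = begin
          fromℕ m + fromℤ q * fromℕ n       ≈⟨ +-congˡ (fromℤ-* q (+ n)) ⟨
          fromℕ m + fromℤ (q ℤ.* + n)       ≈⟨ fromℤ-+ (+ m) (q ℤ.* + n) ⟨
          fromℤ (+ m ℤ.+ q ℤ.* + n)         ≡⟨ cong fromℤ (a≡a%ℕn+[a/ℕn]*n (r ℤ.* + ⟦ k ⟧) n {{nonZero n k}}) ⟨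
          fromℤ (r ℤ.* + ⟦ k ⟧)             ∎

      α-σ : ∀ r (r⊥n : ℤ.Coprime r (+ n)) k → α R cos π n (σ n r r⊥n k) ≈ cos (fromℤ r * (fromℕ ⟦ k ⟧ * step n))
      α-σ r r⊥n k = trans (cos-cong rearrange) (cos-residue r k)
        where
        rearrange : ((fromℕ 2 * π) * fromℕ ⟦ σ n r r⊥n k ⟧) * 1/ n ≈ fromℕ (residue n r k) * step n
        rearrange = trans (*-congʳ (trans (*-congˡ (CR.reflexive (cong fromℕ (⟦σ⟧ n r r⊥n k))))
            (*-comm _ _))) (*-assoc _ _ _)

      sample : Pattern → ℕ → Carrier
      sample P k = monomial P (fromℕ k * step n)

      module _ (P : Pattern) (n⊥∏r : ℤ.Coprime (+ n) (Pattern.∏r P)) where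
        open Pattern P using (r) renaming (h to hs)

        term≈ : ∀ k → term R P n n⊥∏r (α R cos π n) k ≈ sample P ⟦ k ⟧
        term≈ k = product-cong {y = factor P (fromℕ ⟦ k ⟧ * step n)}
          (λ j → ^-cong (hs j) (*-congˡ (α-σ (r j) (coprime-factor P n n⊥∏r j) k)))

        T≈ : T R P n n⊥∏r (α R cos π n) ≈ ∑< (ℕ.pred n) (sample P ∘ suc)
        T≈ = ∑-tabulate (ℕ.pred n) term≈

        T[]≈ : ∀ d → T[_] R P n n⊥∏r d (α R cos π n) ≈ ∑< (ℕ.pred n)
            (λ i → only (gcd (suc i) n ℕ.≟ d) (sample P (suc i)))
        T[]≈ d = trans (∑-filter _ _ (allFin (ℕ.pred n)))
            (∑-tabulate (ℕ.pred n) (λ k → only-cong (gcd ⟦ k ⟧ n ℕ.≟ d) (term≈ k)))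
          where
          only-cong : ∀ {P : Set} (P? : Dec P) {x y} → x ≈ y → only P? x ≈ only P? y
          only-cong (yes _) x≈y = x≈y
          only-cong (no _)  _   = refl

    module TwoPrimes
      (P : Pattern) {p q : ℕ} (p-prime : Prime p) (q-prime : Prime q) (p≢q : p ≢ q)
      (B<p : Pattern.B P ℕ.< p) (B<q : Pattern.B P ℕ.< q) (n⊥∏r : ℤ.Coprime (+ (p ℕ.* q)) (Pattern.∏r P))
      where

      open Pattern P using (H; B)

      private
        n = p ℕ.* q

        instance
          p≢0 = prime⇒nonZero p-prime
          q≢0 = prime⇒nonZero q-prime
          n≢0 = ℕ.m*n≢0 p q

        x : Ω n → Carrier
        x = α R cos π n

        g : ℕ → Carrier
        g = sample n P

        S 2^H : Carrier
        S   = fromℤ (S₀ P)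
        2^H = fromℕ (2 ℕ.^ H)

        g0≈2^H : g 0 ≈ 2^H
        g0≈2^H = trans (monomial-cong P (zeroˡ (step n))) (monomial-0 P)

        x+y≈z⇒y≈z-x : ∀ {x y z} → x + y ≈ z → y ≈ z - x
        x+y≈z⇒y≈z-x {x} {y} {z} x+y≈z = trans (solve 2 (λ x y → y := (x :+ y) :- x) refl x y) (+-congʳ x+y≈z)

        T[b]≈ : ∀ {a b} → Prime a → Prime b → n ≡ a ℕ.* b → B ℕ.< a → T[_] R P n n⊥∏r b x ≈ fromℕ a * S - 2^H
        T[b]≈ {a} {b} a-prime b-prime n≡ab B<a = trans (T[]≈ n P n⊥∏r b) (trans
          (x+y≈z⇒y≈z-x (trans (∑<-gcd g a-prime b-prime n≡ab) (trans
            (∑<-cong a (λ l → monomial-cong P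
                (trans (*-congʳ (fromℕ-* l b)) (*-assoc (fromℕ l) (fromℕ b) (step n)))))
            (∑<-cosines P a (fromℕ b * step n) (2≤prime a-prime) abω≈4h
              (λ e e≢0 e≤B → coprime-<prime e a-prime e≢0 (ℕ.≤-<-trans e≤B B<a))))))
          (+-congˡ (-‿cong g0≈2^H)))
          where
          abω≈4h : fromℕ a * (fromℕ b * step n) ≈ fromℕ 4 * (π * 1/ 2)
          abω≈4h = trans (sym (*-assoc _ _ _)) (trans
            (*-congʳ (trans (sym (fromℕ-* a b)) (CR.reflexive (cong fromℕ (≡.sym n≡ab)))))
            (n*step≈4h n))

        T≈n*S-2^H : T R P n n⊥∏r x ≈ fromℕ n * S - 2^H
        T≈n*S-2^H = trans (T≈ n P n⊥∏r) (trans
          (x+y≈z⇒y≈z-x (trans (sym (∑<-pred n g))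
            (∑<-cosines P n (step n) (ℕ.≤-trans (2≤prime p-prime) (ℕ.m≤m*n p q)) (n*step≈4h n)
              (λ e e≢0 e≤B → coprime-<primes e p-prime q-prime e≢0 (ℕ.≤-<-trans e≤B B<p)
                  (ℕ.≤-<-trans e≤B B<q)))))
          (+-congˡ (-‿cong g0≈2^H)))

        T[1]+T[p]+T[q] : T[_] R P n n⊥∏r 1 x + (T[_] R P n n⊥∏r p x + T[_] R P n n⊥∏r q x) ≈ T R P n n⊥∏r x
        T[1]+T[p]+T[q] = trans
          (+-cong (T[]≈ n P n⊥∏r 1) (+-cong (T[]≈ n P n⊥∏r p) (T[]≈ n P n⊥∏r q)))
          (trans (∑<-gcd-partition g p-prime q-prime p≢q) (sym (T≈ n P n⊥∏r)))

        fromℤ-i*S₀-2^H : ∀ i → fromℤ (i ℤ.* S₀ P ℤ.- + (2 ℕ.^ H)) ≈ fromℤ i * S - 2^H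
        fromℤ-i*S₀-2^H i = trans (fromℤ-+ (i ℤ.* S₀ P) (ℤ.- + (2 ℕ.^ H)))
          (+-cong (fromℤ-* i (S₀ P)) (fromℤ-neg (+ (2 ℕ.^ H))))

      T[p]≈ : T[_] R P n n⊥∏r p x ≈ fromℤ (+ q ℤ.* S₀ P ℤ.- + (2 ℕ.^ H))
      T[p]≈ = trans (T[b]≈ q-prime p-prime (ℕ.*-comm p q) B<q) (sym (fromℤ-i*S₀-2^H (+ q)))

      T[q]≈ : T[_] R P n n⊥∏r q x ≈ fromℤ (+ p ℤ.* S₀ P ℤ.- + (2 ℕ.^ H))
      T[q]≈ = trans (T[b]≈ p-prime q-prime ≡.refl B<p) (sym (fromℤ-i*S₀-2^H (+ p)))

      T[pq]≈ : T R P n n⊥∏r x ≈ fromℤ (+ p ℤ.* + q ℤ.* S₀ P ℤ.- + (2 ℕ.^ H))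
      T[pq]≈ = trans T≈n*S-2^H (trans
        (+-congʳ (*-congʳ (trans (fromℕ-* p q) (sym (fromℤ-* (+ p) (+ q))))))
        (sym (fromℤ-i*S₀-2^H (+ p ℤ.* + q))))

      T[1]≈ : T[_] R P n n⊥∏r 1 x ≈
        fromℤ (((+ p ℤ.- 1ℤ) ℤ.* (+ q ℤ.- 1ℤ) ℤ.- 1ℤ) ℤ.* S₀ P ℤ.+ + (2 ℕ.^ H))
      T[1]≈ = begin
        T[_] R P n n⊥∏r 1 x
          ≈⟨ solve 2 (λ a b → a := (a :+ b) :- b) refl (T[_] R P n n⊥∏r 1 x)
              (T[_] R P n n⊥∏r p x + T[_] R P n n⊥∏r q x) ⟩
        (T[_] R P n n⊥∏r 1 x + (T[_] R P n n⊥∏r p x + T[_] R P n n⊥∏r q x)) -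
            (T[_] R P n n⊥∏r p x + T[_] R P n n⊥∏r q x)
          ≈⟨ +-cong T[1]+T[p]+T[q] (-‿cong (+-cong (T[b]≈ q-prime p-prime (ℕ.*-comm p q) B<q)
              (T[b]≈ p-prime q-prime ≡.refl B<p))) ⟩
        T R P n n⊥∏r x - ((fromℕ q * S - 2^H) + (fromℕ p * S - 2^H))
          ≈⟨ +-congʳ (trans T≈n*S-2^H (+-congʳ (*-congʳ (fromℕ-* p q)))) ⟩
        ((fromℕ p * fromℕ q) * S - 2^H) - ((fromℕ q * S - 2^H) + (fromℕ p * S - 2^H))
          ≈⟨ solve 4 (λ p q s w → ((p :* q) :* s :- w) :- ((q :* s :- w) :+ (p :* s :- w)) :=
               ((p :- con 1ℤ) :* (q :- con 1ℤ) :- con 1ℤ) :* s :+ w) refl (fromℕ p) (fromℕ q) S 2^H ⟩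
        ((fromℕ p - fromℕ 1) * (fromℕ q - fromℕ 1) - fromℕ 1) * S + 2^H
          ≈⟨ +-congʳ (*-congʳ (+-congʳ (*-cong (fromℤ-+ (+ p) (ℤ.- 1ℤ)) (fromℤ-+ (+ q) (ℤ.- 1ℤ))))) ⟨
        (fromℤ (+ p ℤ.- 1ℤ) * fromℤ (+ q ℤ.- 1ℤ) - fromℕ 1) * S + 2^H
          ≈⟨ +-congʳ (*-congʳ (trans (fromℤ-+ (i ℤ.* j) (ℤ.- 1ℤ)) (+-congʳ (fromℤ-* i j)))) ⟨
        fromℤ (i ℤ.* j ℤ.- 1ℤ) * S + 2^H
          ≈⟨ trans (fromℤ-+ ((i ℤ.* j ℤ.- 1ℤ) ℤ.* S₀ P) (+ (2 ℕ.^ H)))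
              (+-congʳ (fromℤ-* (i ℤ.* j ℤ.- 1ℤ) (S₀ P))) ⟨
        fromℤ ((i ℤ.* j ℤ.- 1ℤ) ℤ.* S₀ P ℤ.+ + (2 ℕ.^ H))
          ∎
        where
        i = + p ℤ.- 1ℤ
        j = + q ℤ.- 1ℤ

theorem4p11 :
  ∀ {c ℓ₁ ℓ₂ ℓ₃} (R : RealNumbers c ℓ₁ ℓ₂ ℓ₃) (let open RealNumbers R) →
  (cos : Carrier → Carrier) → IsCosine R cos →
  (π : Carrier) → IsPi R cos π →
  (P : Pattern) (let open Pattern P) →
  (p q : ℕ) (p-prime : Prime p) (q-prime : Prime q) → p ≢ q →
  B ℕ.< p → B ℕ.< q →
  (p∤∏r : ¬ (+ p ∣ ∏r)) (q∤∏r : ¬ (+ q ∣ ∏r)) →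
  let n    = p ℕ.* q
      n⊥∏r = pq-coprime p q ∏r p-prime q-prime p∤∏r q∤∏r
      x    = α R cos π n
  in
  (T[_] R P n n⊥∏r p x ≈ fromℤ (+ q ℤ.* S₀ P ℤ.- + (2 ℕ.^ H))) ×
  (T[_] R P n n⊥∏r q x ≈ fromℤ (+ p ℤ.* S₀ P ℤ.- + (2 ℕ.^ H))) ×
  (T[_] R P n n⊥∏r 1 x ≈
    fromℤ (((+ p ℤ.- 1ℤ) ℤ.* (+ q ℤ.- 1ℤ) ℤ.- 1ℤ) ℤ.* S₀ P ℤ.+ + (2 ℕ.^ H))) ×
  (T R P n n⊥∏r x ≈ fromℤ (+ p ℤ.* + q ℤ.* S₀ P ℤ.- + (2 ℕ.^ H)))
theorem4p11 R cos isCosine π isPi P p q p-prime q-prime p≢q B<p B<q p∤∏r q∤∏r =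
  Sums.T[p]≈ , Sums.T[q]≈ , Sums.T[1]≈ , Sums.T[pq]≈
  where
  module Sums = Reals.Evaluation.TwoPrimes R isCosine isPi P p-prime q-prime p≢q B<p B<q
    (pq-coprime p q (Pattern.∏r P) p-prime q-prime p∤∏r q∤∏r)
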